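{- Let $k\geq 0$ and $n\geq 1$ be integers, let $Q_m^{(k)}$ denote the $k$th derivative of $Q_m$, and set $\Delta_{k,n}:=R\big(Q_{n+k}^{(k)}(x),Q_{n-1+k}^{(k)}(x)\big)$. Then \[ \Delta_{k,n} = \frac{2(2k+n)}{n}\left(\frac{(2k+2n)!}{n!(k+n)!}\right)^{n-2} \left(\frac{(2k+n-1)!}{(k+n-1)!}\right)^nQ_{n-1+k}^{(k)}\!\left(-\frac{n+2k}{2(n+k)}\right). \]
   Context: For each integer $m\geq 0$, $P_m(x),Q_m(x)\in\mathbb{Q}[x]$ denote the unique pair of polynomials with $\deg P_m\leq m$, $\deg Q_m\leq m$ satisfying $P_m(x)x^{m+1}+Q_m(x)(x+1)^{m+1}=1$. For polynomials $f(x)=a_0(x-\alpha_1)\cdots(x-\alpha_\mu)$ with $a_0\neq0$ and $g$, the resultant (with respect to $x$) is $R(f,g)=a_0^{\deg g}\prod_{i=1}^\mu g(\alpha_i)$; if $f=a$ is a nonzero constant, $R(a,g)=a^{\deg g}$. -}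

module Defs where

open import Data.Nat as ℕ using (ℕ; zero; suc; _≤?_; _<?_)
open import Data.Integer as ℤ using (ℤ; +_; -[1+_])
open import Data.Rational using (ℚ; 0ℚ; 1ℚ; _+_; _*_; -_; 1/_; ≢-nonZero)
open import Data.Rational.Properties using (_≟_)
open import Data.Fin using (Fin; zero; suc; toℕ; punchIn)
open import Data.List using (List; []; _∷_; length)
open import Relation.Nullary using (yes; no)
open import Data.Bool using (Bool; true; false)
open import Data.Product using (_×_)
open import Relation.Binary.PropositionalEquality using (_≡_)

-- Polynomials over ℚ as coefficient lists, lowest degree first.

Poly : Set
Poly = List ℚ

coeff : Poly → ℕ → ℚ
coeff []       _       = 0ℚ
coeff (a ∷ p)  zero    = a
coeff (a ∷ p)  (suc i) = coeff p i

infix 4 _≈ₚ_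
_≈ₚ_ : Poly → Poly → Set
p ≈ₚ q = ∀ i → coeff p i ≡ coeff q i

DegLe : Poly → ℕ → Set
DegLe p m = ∀ i → m ℕ.< i → coeff p i ≡ 0ℚ

infixl 6 _+ₚ_
infixl 7 _*ₚ_ _·ₚ_

_+ₚ_ : Poly → Poly → Poly
[]      +ₚ q       = q
p       +ₚ []      = p
(a ∷ p) +ₚ (b ∷ q) = (a + b) ∷ (p +ₚ q)

_·ₚ_ : ℚ → Poly → Poly
c ·ₚ []      = []
c ·ₚ (a ∷ p) = (c * a) ∷ (c ·ₚ p)

_*ₚ_ : Poly → Poly → Poly
[]      *ₚ q = []
(a ∷ p) *ₚ q = (a ·ₚ q) +ₚ (0ℚ ∷ (p *ₚ q))

infixr 8 _^ₚ_
_^ₚ_ : Poly → ℕ → Poly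
p ^ₚ zero  = 1ℚ ∷ []
p ^ₚ suc n = p *ₚ (p ^ₚ n)

oneₚ xₚ x+1ₚ : Poly
oneₚ = 1ℚ ∷ []
xₚ   = 0ℚ ∷ 1ℚ ∷ []
x+1ₚ = 1ℚ ∷ 1ℚ ∷ []

fromℕℚ : ℕ → ℚ
fromℕℚ n = (+ n) Data.Rational./ 1

private
  derivAux : ℕ → Poly → Poly
  derivAux i []      = []
  derivAux i (a ∷ p) = (fromℕℚ i * a) ∷ derivAux (suc i) p

deriv : Poly → Poly
deriv []      = []
deriv (a ∷ p) = derivAux 1 p

derivN : ℕ → Poly → Poly
derivN zero    p = p
derivN (suc k) p = deriv (derivN k p)

eval : Poly → ℚ → ℚ
eval []      x = 0ℚ
eval (a ∷ p) x = a + x * eval p x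

-- actual degree (the zero polynomial gets degree 0; it never occurs below)
isZeroPoly : Poly → Bool
isZeroPoly []      = true
isZeroPoly (b ∷ q) with b ≟ 0ℚ
... | yes _ = isZeroPoly q
... | no  _ = false

degree : Poly → ℕ
degree []      = 0
degree (a ∷ p) with isZeroPoly p
... | true  = 0
... | false = suc (degree p)

sumFin : ∀ n → (Fin n → ℚ) → ℚ
sumFin zero    f = 0ℚ
sumFin (suc n) f = f zero + sumFin n (λ j → f (suc j))

sign : ℕ → ℚ
sign zero          = 1ℚ
sign (suc zero)    = - 1ℚ
sign (suc (suc n)) = sign n

det : ∀ n → (Fin n → Fin n → ℚ) → ℚ
det zero    M = 1ℚ
det (suc n) M = sumFin (suc n) λ j →
  sign (toℕ j) * M zero j * det n (λ r c → M (suc r) (punchIn j c))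

-- Resultant R(f,g) as the determinant of the Sylvester matrix
-- (size deg f + deg g; rows 0..deg g - 1 carry the shifted coefficients
-- of f, the remaining deg f rows those of g, leading coefficients first).

sylEntry : Poly → ℕ → ℕ → ℕ → ℚ
sylEntry f d s j with s ℕ.≤? j
... | no  _ = 0ℚ
... | yes _ with (j ℕ.∸ s) ℕ.≤? d
...   | yes _ = coeff f (d ℕ.∸ (j ℕ.∸ s))
...   | no  _ = 0ℚ

sylvester : (f g : Poly) → Fin (degree f ℕ.+ degree g) → Fin (degree f ℕ.+ degree g) → ℚ
sylvester f g i j with toℕ i ℕ.<? degree g
... | yes _ = sylEntry f (degree f) (toℕ i) (toℕ j)
... | no  _ = sylEntry g (degree g) (toℕ i ℕ.∸ degree g) (toℕ j)

resultant : Poly → Poly → ℚ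
resultant f g = det (degree f ℕ.+ degree g) (sylvester f g)

-- inverse (total; only used on nonzero arguments)
inv : ℚ → ℚ
inv p with p ≟ 0ℚ
... | yes _ = 0ℚ
... | no ne = 1/_ p {{≢-nonZero ne}}

infixr 8 _^ℕ_ _^ℤ_
_^ℕ_ : ℚ → ℕ → ℚ
q ^ℕ zero  = 1ℚ
q ^ℕ suc n = q * (q ^ℕ n)

_^ℤ_ : ℚ → ℤ → ℚ
q ^ℤ (+ n)    = q ^ℕ n
q ^ℤ -[1+ n ] = inv (q ^ℕ suc n)

infixl 7 _÷'_
_÷'_ : ℚ → ℚ → ℚ
p ÷' q = p * inv q

-- (P , Q) is the pair (P_m , Q_m): deg P ≤ m, deg Q ≤ m and
-- P(x) x^(m+1) + Q(x) (x+1)^(m+1) = 1.  (Such a pair exists and is unique.)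

IsPQ : ℕ → Poly → Poly → Set
IsPQ m P Q =
  DegLe P m × DegLe Q m ×
  (P *ₚ (xₚ ^ₚ suc m) +ₚ Q *ₚ (x+1ₚ ^ₚ suc m) ≈ₚ oneₚ)

{-# OPTIONS --safe #-}

-- Write A = Q_{n+k}^{(k)} and B = Q_{n-1+k}^{(k)}. Up to scalars they are the truncations of
-- (1+x)^{-(n+2k+1)} and (1+x)^{-(n+2k)} at degrees n and n-1, so (n+k)(1+x)A - (n+2k)B only has terms
-- of degree n and n+1: it equals xⁿ(c + dx) with c/d = (n+2k)/(2(n+k)). Padding the Sylvester matrix by
-- two rows of A multiplies the resultant by lead(A)²; row operations then replace B by xⁿ(c + dx), and the
-- matrix becomes block triangular, one block contributing A(0)ⁿ and the other (-d)ⁿ A(-c/d). Finally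
-- the relation at x = -c/d turns A(-c/d) into a multiple of B(-c/d).
module Submission where

open import Defs
open import Data.Bool using (true; false)
open import Data.Empty using (⊥-elim)
open import Data.Fin using (Fin; toℕ; punchIn)
open import Data.Integer as ℤ using (+_)
import Data.Integer.Properties as ℤP
open import Data.List using (List; []; _∷_; _++_; length; applyUpTo)
open import Data.List.Membership.Propositional using (_∈_)
open import Data.List.Membership.Propositional.Properties using (∈-∃++; ∈-++⁺ʳ; ∈-applyUpTo⁺)
open import Data.List.Properties using (length-applyUpTo; length-++; ++-identityʳ)
open import Data.List.Relation.Binary.Pointwise as PW using (Pointwise; []; _∷_)
open import Data.List.Relation.Unary.All as All using (All; []; _∷_)
import Data.List.Relation.Unary.All.Properties as AllP
open import Data.Nat as ℕ using (ℕ; zero; suc; _≤_; _<_; z≤n; s≤s; _∸_; _!)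
import Data.Nat.Properties as ℕP
open import Data.Nat.Tactic.RingSolver using () renaming (solve-∀ to solveℕ-∀)
open import Data.Product using (_×_; _,_; ∃; proj₁; proj₂)
open import Data.Rational using (ℚ; 0ℚ; 1ℚ; _+_; _*_; -_; ½; toℚᵘ; ≢-nonZero)
open import Data.Rational.Properties using (_≟_; +-*-commutativeRing; *-zeroˡ; *-zeroʳ; *-identityˡ; *-identityʳ; +-identityˡ; +-identityʳ; *-assoc; *-comm; *-distribˡ-+; +-assoc; +-comm; neg-distribˡ-*; toℚᵘ-injective; toℚᵘ-homo-+; toℚᵘ-homo-*; toℚᵘ-fromℚᵘ; *-inverseʳ)
open import Data.Rational.Unnormalised as ℚᵘ using (mkℚᵘ; *≡*)
import Data.Rational.Unnormalised.Properties as ℚᵘP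
open import Function using (_∘_; id)
open import Relation.Binary.Definitions using (tri<; tri≈; tri>)
open import Relation.Binary.PropositionalEquality using (_≡_; _≢_; refl; sym; trans; cong; cong₂; subst; module ≡-Reasoning)
open import Relation.Nullary using (yes; no)
open import Relation.Nullary.Decidable using (dec⇒maybe)
open import Tactic.RingSolver using (solve-∀)
open import Tactic.RingSolver.Core.AlmostCommutativeRing using (AlmostCommutativeRing; fromCommutativeRing)

open ≡-Reasoning

ring : AlmostCommutativeRing _ _
ring = fromCommutativeRing +-*-commutativeRing (λ x → dec⇒maybe (0ℚ ≟ x))

self-neg⇒0 : ∀ x → x ≡ - x → x ≡ 0ℚ
self-neg⇒0 x e = begin
  x                  ≡⟨ sym (*-identityˡ x) ⟩
  (½ + ½) * x        ≡⟨ half-sum ½ x ⟩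
  ½ * (x + x)        ≡⟨ cong (λ y → ½ * (x + y)) e ⟩
  ½ * (x + - x)      ≡⟨ cancel ½ x ⟩
  0ℚ                 ∎
  where
  half-sum : ∀ h x → (h + h) * x ≡ h * (x + x)
  half-sum = solve-∀ ring
  cancel : ∀ h x → h * (x + - x) ≡ 0ℚ
  cancel = solve-∀ ring

-- Signs and finite sums

sign-suc : ∀ n → sign (suc n) ≡ - sign n
sign-suc zero          = refl
sign-suc (suc zero)    = refl
sign-suc (suc (suc n)) = sign-suc n

sign-+ : ∀ m n → sign (m ℕ.+ n) ≡ sign m * sign n
sign-+ zero    n = sym (*-identityˡ _)
sign-+ (suc m) n = begin
  sign (suc (m ℕ.+ n))   ≡⟨ sign-suc (m ℕ.+ n) ⟩
  - sign (m ℕ.+ n)       ≡⟨ cong -_ (sign-+ m n) ⟩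
  - (sign m * sign n)    ≡⟨ neg-distribˡ-* (sign m) (sign n) ⟩
  - sign m * sign n      ≡⟨ cong (_* sign n) (sym (sign-suc m)) ⟩
  sign (suc m) * sign n  ∎

sign-sq : ∀ n → sign n * sign n ≡ 1ℚ
sign-sq zero          = refl
sign-sq (suc zero)    = refl
sign-sq (suc (suc n)) = sign-sq n

sign-even : ∀ n → sign (n ℕ.+ n) ≡ 1ℚ
sign-even n = trans (sign-+ n n) (sign-sq n)

sign-pronic : ∀ n → sign (suc n ℕ.* n) ≡ 1ℚ
sign-pronic zero    = refl
sign-pronic (suc n) = begin
  sign (suc (suc n) ℕ.* suc n)                    ≡⟨ cong (λ z → sign (suc n ℕ.+ (suc n ℕ.+ z))) (ℕP.*-suc n n) ⟩
  sign (suc n ℕ.+ (suc n ℕ.+ suc n ℕ.* n))        ≡⟨ cong sign (sym (ℕP.+-assoc (suc n) (suc n) _)) ⟩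
  sign ((suc n ℕ.+ suc n) ℕ.+ suc n ℕ.* n)        ≡⟨ sign-+ (suc n ℕ.+ suc n) _ ⟩
  sign (suc n ℕ.+ suc n) * sign (suc n ℕ.* n)     ≡⟨ cong₂ _*_ (sign-even (suc n)) (sign-pronic n) ⟩
  1ℚ                                              ∎

∑ : ℕ → (ℕ → ℚ) → ℚ
∑ zero    f = 0ℚ
∑ (suc n) f = f 0 + ∑ n (f ∘ suc)

∑-cong : ∀ n {f g} → (∀ j → j < n → f j ≡ g j) → ∑ n f ≡ ∑ n g
∑-cong zero    e = refl
∑-cong (suc n) e = cong₂ _+_ (e 0 (s≤s z≤n)) (∑-cong n (λ j j<n → e (suc j) (s≤s j<n)))

∑-zero : ∀ n f → (∀ j → j < n → f j ≡ 0ℚ) → ∑ n f ≡ 0ℚ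
∑-zero zero    f e = refl
∑-zero (suc n) f e = cong₂ _+_ (e 0 (s≤s z≤n)) (∑-zero n (f ∘ suc) (λ j j<n → e (suc j) (s≤s j<n)))

∑-*ˡ : ∀ n c f → ∑ n (λ j → c * f j) ≡ c * ∑ n f
∑-*ˡ zero    c f = sym (*-zeroʳ c)
∑-*ˡ (suc n) c f = trans (cong (λ z → c * f 0 + z) (∑-*ˡ n c (f ∘ suc))) (sym (*-distribˡ-+ c _ _))

∑-+ : ∀ n f g → ∑ n (λ j → f j + g j) ≡ ∑ n f + ∑ n g
∑-+ zero    f g = refl
∑-+ (suc n) f g = trans (cong (λ z → f 0 + g 0 + z) (∑-+ n (f ∘ suc) (g ∘ suc))) (interchange (f 0) (g 0) (∑ n (f ∘ suc)) (∑ n (g ∘ suc)))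
  where
  interchange : ∀ a b c d → a + b + (c + d) ≡ a + c + (b + d)
  interchange = solve-∀ ring

∑-neg : ∀ n f → ∑ n (λ j → - f j) ≡ - ∑ n f
∑-neg n f = trans (∑-cong n (λ j _ → neg-one (f j))) (trans (∑-*ˡ n (- 1ℚ) f) (sym (neg-one (∑ n f))))
  where
  neg-one : ∀ x → - x ≡ (- 1ℚ) * x
  neg-one = solve-∀ ring

∑-split : ∀ m n f → ∑ (m ℕ.+ n) f ≡ ∑ m f + ∑ n (λ j → f (m ℕ.+ j))
∑-split zero    n f = sym (+-identityˡ _)
∑-split (suc m) n f = trans (cong (λ z → f 0 + z) (∑-split m n (f ∘ suc))) (sym (+-assoc (f 0) (∑ m (f ∘ suc)) _))

∑-snoc : ∀ n f → ∑ (suc n) f ≡ ∑ n f + f n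
∑-snoc zero    f = +-comm (f 0) 0ℚ
∑-snoc (suc n) f = trans (cong (λ z → f 0 + z) (∑-snoc n (f ∘ suc))) (sym (+-assoc (f 0) (∑ n (f ∘ suc)) _))

-- Under (j , i) ↦ (suc i , j) for j ≤ i, the pairs indexing the two sums are exchanged.
∑∑-antisym : ∀ n (S T : ℕ → ℕ → ℚ) →
  (∀ {j i} → j ≤ i → S (suc i) j ≡ - T j i) →
  (∀ {j i} → j ≤ i → T (suc i) j ≡ - S j i) →
  ∑ (suc n) (λ j → ∑ n (S j)) ≡ - ∑ (suc n) (λ j → ∑ n (T j))
∑∑-antisym zero    S T st ts = refl
∑∑-antisym (suc n) S T st ts = begin
  ∑ (suc n) (S 0) + ∑ (suc n) (λ j → S (suc j) 0 + ∑ n (S (suc j) ∘ suc))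
    ≡⟨ cong₂ _+_
         (trans (∑-cong (suc n) (λ i _ → trans (sym (neg-neg (S 0 i))) (cong -_ (sym (ts (z≤n {i}))))))
                (∑-neg (suc n) (λ i → T (suc i) 0)))
         (trans (∑-+ (suc n) (λ j → S (suc j) 0) (λ j → ∑ n (S (suc j) ∘ suc)))
                (cong₂ _+_
                  (trans (∑-cong (suc n) (λ i _ → st (z≤n {i}))) (∑-neg (suc n) (T 0)))
                  (∑∑-antisym n (λ j i → S (suc j) (suc i)) (λ j i → T (suc j) (suc i))
                    (λ p → st (s≤s p)) (λ p → ts (s≤s p))))) ⟩
  - ∑ (suc n) (λ i → T (suc i) 0) + (- ∑ (suc n) (T 0) + - ∑ (suc n) (λ j → ∑ n (T (suc j) ∘ suc)))
    ≡⟨ regroup (∑ (suc n) (λ i → T (suc i) 0)) (∑ (suc n) (T 0)) (∑ (suc n) (λ j → ∑ n (T (suc j) ∘ suc))) ⟩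
  - (∑ (suc n) (T 0) + (∑ (suc n) (λ i → T (suc i) 0) + ∑ (suc n) (λ j → ∑ n (T (suc j) ∘ suc))))
    ≡⟨ cong (λ z → - (∑ (suc n) (T 0) + z)) (sym (∑-+ (suc n) (λ j → T (suc j) 0) (λ j → ∑ n (T (suc j) ∘ suc)))) ⟩
  - (∑ (suc n) (T 0) + ∑ (suc n) (λ j → T (suc j) 0 + ∑ n (T (suc j) ∘ suc))) ∎
  where
  neg-neg : ∀ x → - (- x) ≡ x
  neg-neg = solve-∀ ring
  regroup : ∀ a b c → - a + (- b + - c) ≡ - (b + (a + c))
  regroup = solve-∀ ring

-- Determinants of lists of rows

Row : Set
Row = ℕ → ℚ

skip : ℕ → ℕ → ℕ
skip zero    c       = suc c
skip (suc j) zero    = zero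
skip (suc j) (suc c) = suc (skip j c)

skip-skip : ∀ {j i} → j ≤ i → ∀ c → skip j (skip i c) ≡ skip (suc i) (skip j c)
skip-skip z≤n       c       = refl
skip-skip (s≤s j≤i) zero    = refl
skip-skip (s≤s j≤i) (suc c) = cong suc (skip-skip j≤i c)

skip-≤ : ∀ {j i} → j ≤ i → skip j i ≡ suc i
skip-≤ z≤n       = refl
skip-≤ (s≤s j≤i) = cong suc (skip-≤ j≤i)

skip-> : ∀ {j i} → j ≤ i → skip (suc i) j ≡ j
skip-> z≤n       = refl
skip-> (s≤s j≤i) = cong suc (skip-> j≤i)

-- The determinant of the square matrix whose c-th column consists of the σ c-th entries of the rows.
-- Carrying σ keeps the recursion structural and lets minors share their rows.
detRows : List Row → (ℕ → ℕ) → ℚ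
detRows []       σ = 1ℚ
detRows (r ∷ rs) σ = ∑ (suc (length rs)) λ j → sign j * r (σ j) * detRows rs (σ ∘ skip j)

SameOn : (σ τ : ℕ → ℕ) → Row → Row → Set
SameOn σ τ r s = ∀ c → r (σ c) ≡ s (τ c)

detRows-cong : ∀ {rs ss σ τ} → Pointwise (SameOn σ τ) rs ss → detRows rs σ ≡ detRows ss τ
detRows-cong []       = refl
detRows-cong {r ∷ rs} {s ∷ ss} {σ} {τ} (e ∷ es) = begin
  ∑ (suc (length rs)) (λ j → sign j * r (σ j) * detRows rs (σ ∘ skip j))
    ≡⟨ ∑-cong (suc (length rs)) (λ j _ → cong₂ (λ x y → sign j * x * y) (e j)
         (detRows-cong (PW.map (λ h c → h (skip j c)) es))) ⟩
  ∑ (suc (length rs)) (λ j → sign j * s (τ j) * detRows ss (τ ∘ skip j))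
    ≡⟨ cong (λ l → ∑ (suc l) (λ j → sign j * s (τ j) * detRows ss (τ ∘ skip j))) (PW.Pointwise-length es) ⟩
  ∑ (suc (length ss)) (λ j → sign j * s (τ j) * detRows ss (τ ∘ skip j)) ∎

detRows-cols : ∀ rs {σ τ} → (∀ c → σ c ≡ τ c) → detRows rs σ ≡ detRows rs τ
detRows-cols rs e = detRows-cong {rs} {rs} (PW.refl (λ {r} c → cong r (e c)))

toℕ-punchIn : ∀ {n} (j : Fin (suc n)) c → toℕ (punchIn j c) ≡ skip (toℕ j) (toℕ c)
toℕ-punchIn Fin.zero    c           = refl
toℕ-punchIn (Fin.suc j) Fin.zero    = refl
toℕ-punchIn (Fin.suc j) (Fin.suc c) = cong suc (toℕ-punchIn j c)

sumFin≡∑ : ∀ n {f} g → (∀ j → f j ≡ g (toℕ j)) → sumFin n f ≡ ∑ n g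
sumFin≡∑ zero    g e = refl
sumFin≡∑ (suc n) g e = cong₂ _+_ (e Fin.zero) (sumFin≡∑ n (g ∘ suc) (e ∘ Fin.suc))

det≡detRows : ∀ n {M} R σ → (∀ i j → M i j ≡ R (toℕ i) (σ (toℕ j))) →
  det n M ≡ detRows (applyUpTo R n) σ
det≡detRows zero    R σ e = refl
det≡detRows (suc n) {M} R σ e = begin
  sumFin (suc n) (λ j → sign (toℕ j) * M Fin.zero j * det n (λ r c → M (Fin.suc r) (punchIn j c)))
    ≡⟨ sumFin≡∑ (suc n) F (λ j → cong₂ (λ x y → sign (toℕ j) * x * y) (e Fin.zero j)
         (det≡detRows n (R ∘ suc) (σ ∘ skip (toℕ j))
           (λ r c → trans (e (Fin.suc r) (punchIn j c)) (cong (R (suc (toℕ r)) ∘ σ) (toℕ-punchIn j c))))) ⟩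
  ∑ (suc n) F
    ≡⟨ cong (λ l → ∑ (suc l) F) (sym (length-applyUpTo (R ∘ suc) n)) ⟩
  detRows (applyUpTo R (suc n)) σ ∎
  where
  F : ℕ → ℚ
  F j = sign j * R 0 (σ j) * detRows (applyUpTo (R ∘ suc) n) (σ ∘ skip j)

zero-column : ∀ r rs σ → All (λ s → s (σ 0) ≡ 0ℚ) (r ∷ rs) → detRows (r ∷ rs) σ ≡ 0ℚ
zero-column r []       σ (e ∷ _)  = cong (λ x → 1ℚ * x * 1ℚ + 0ℚ) e
zero-column r (s ∷ rs) σ (e ∷ es) = ∑-zero (suc (suc (length rs))) F terms
  where
  N : ℕ → ℚ
  N j = detRows (s ∷ rs) (σ ∘ skip j)
  F : ℕ → ℚ
  F j = sign j * r (σ j) * N j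
  terms : ∀ j → j < suc (suc (length rs)) → F j ≡ 0ℚ
  terms zero    _ = trans (cong (λ x → 1ℚ * x * N 0) e) (*-zeroˡ (N 0))
  terms (suc j) _ = trans (cong (sign (suc j) * r (σ (suc j)) *_) (zero-column s rs (σ ∘ skip (suc j)) es))
                          (*-zeroʳ (sign (suc j) * r (σ (suc j))))

expand-first-column : ∀ r rs σ → All (λ s → s (σ 0) ≡ 0ℚ) rs →
  detRows (r ∷ rs) σ ≡ r (σ 0) * detRows rs (σ ∘ suc)
expand-first-column r rs σ es = begin
  1ℚ * r (σ 0) * detRows rs (σ ∘ suc) + ∑ (length rs) (λ j → sign (suc j) * r (σ (suc j)) * detRows rs (σ ∘ skip (suc j)))
    ≡⟨ cong₂ _+_ (cong (_* detRows rs (σ ∘ suc)) (*-identityˡ (r (σ 0)))) (rest rs es) ⟩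
  r (σ 0) * detRows rs (σ ∘ suc) + 0ℚ
    ≡⟨ +-identityʳ _ ⟩
  r (σ 0) * detRows rs (σ ∘ suc) ∎
  where
  rest : ∀ rs → All (λ s → s (σ 0) ≡ 0ℚ) rs →
    ∑ (length rs) (λ j → sign (suc j) * r (σ (suc j)) * detRows rs (σ ∘ skip (suc j))) ≡ 0ℚ
  rest []       es = refl
  rest (s ∷ ss) es = ∑-zero (suc (length ss)) (λ j → sign (suc j) * r (σ (suc j)) * detRows (s ∷ ss) (σ ∘ skip (suc j))) λ j _ →
    trans (cong (sign (suc j) * r (σ (suc j)) *_) (zero-column s ss (σ ∘ skip (suc j)) es)) (*-zeroʳ (sign (suc j) * r (σ (suc j))))

skip-+ : ∀ {j m} → j ≤ m → ∀ c → skip j (m ℕ.+ c) ≡ suc (m ℕ.+ c)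
skip-+ j≤m c = skip-≤ (ℕP.≤-trans j≤m (ℕP.m≤m+n _ c))

block-triangular : ∀ xs ys σ → All (λ r → ∀ c → r (σ (length xs ℕ.+ c)) ≡ 0ℚ) xs →
  detRows (xs ++ ys) σ ≡ detRows xs σ * detRows ys (λ c → σ (length xs ℕ.+ c))
block-triangular []       ys σ es       = sym (*-identityˡ _)
block-triangular (x ∷ xs) ys σ (e ∷ es) = begin
  ∑ (suc (length (xs ++ ys))) F
    ≡⟨ cong (λ l → ∑ (suc l) F) (length-++ xs) ⟩
  ∑ (suc m ℕ.+ length ys) F
    ≡⟨ ∑-split (suc m) (length ys) F ⟩
  ∑ (suc m) F + ∑ (length ys) (λ j → F (suc m ℕ.+ j))
    ≡⟨ cong₂ _+_
        (∑-cong (suc m) (λ j j<m → trans (cong (sign j * x (σ j) *_) (minor j (ℕP.≤-pred j<m))) (pull (sign j * x (σ j)) (detRows xs (σ ∘ skip j)) Y)))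
        (∑-zero (length ys) (λ j → F (suc m ℕ.+ j)) (λ j _ → trans (cong (λ z → sign (suc m ℕ.+ j) * z * N (suc m ℕ.+ j)) (e j)) (kill (sign (suc m ℕ.+ j)) (N (suc m ℕ.+ j))))) ⟩
  ∑ (suc m) (λ j → Y * (sign j * x (σ j) * detRows xs (σ ∘ skip j))) + 0ℚ
    ≡⟨ +-identityʳ _ ⟩
  ∑ (suc m) (λ j → Y * (sign j * x (σ j) * detRows xs (σ ∘ skip j)))
    ≡⟨ ∑-*ˡ (suc m) Y (λ j → sign j * x (σ j) * detRows xs (σ ∘ skip j)) ⟩
  Y * detRows (x ∷ xs) σ
    ≡⟨ *-comm Y (detRows (x ∷ xs) σ) ⟩
  detRows (x ∷ xs) σ * Y ∎
  where
  m = length xs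
  N : ℕ → ℚ
  N j = detRows (xs ++ ys) (σ ∘ skip j)
  F : ℕ → ℚ
  F j = sign j * x (σ j) * N j
  Y = detRows ys (λ c → σ (suc m ℕ.+ c))
  minor : ∀ j → j ≤ m → N j ≡ detRows xs (σ ∘ skip j) * Y
  minor j j≤m = trans
    (block-triangular xs ys (σ ∘ skip j)
      (All.map (λ {r} h c → trans (cong (r ∘ σ) (skip-+ j≤m c)) (h c)) es))
    (cong (detRows xs (σ ∘ skip j) *_) (detRows-cols ys (λ c → cong σ (skip-+ j≤m c))))
  pull : ∀ a b y → a * (b * y) ≡ y * (a * b)
  pull = solve-∀ ring
  kill : ∀ a b → a * 0ℚ * b ≡ 0ℚ
  kill = solve-∀ ring

record Alternating (Φ : List Row → ℚ) : Set where
  field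
    linear : ∀ zs ws r u v α β → (∀ c → r c ≡ α * u c + β * v c) →
      Φ (zs ++ r ∷ ws) ≡ α * Φ (zs ++ u ∷ ws) + β * Φ (zs ++ v ∷ ws)
    swap : ∀ zs x y ws → Φ (zs ++ x ∷ y ∷ ws) ≡ - Φ (zs ++ y ∷ x ∷ ws)

length-middle : ∀ (zs : List Row) x y ws → length (zs ++ x ∷ ws) ≡ length (zs ++ y ∷ ws)
length-middle zs x y ws = trans (length-++ zs) (sym (length-++ zs))

detRows-linear : ∀ σ zs ws r u v α β → (∀ c → r c ≡ α * u c + β * v c) →
  detRows (zs ++ r ∷ ws) σ ≡ α * detRows (zs ++ u ∷ ws) σ + β * detRows (zs ++ v ∷ ws) σ
detRows-linear σ [] ws r u v α β e = begin
  ∑ l (term r)                              ≡⟨ ∑-cong l (λ j _ → trans (cong (λ x → sign j * x * N j) (e (σ j)))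
                                                 (distrib (sign j) α β (u (σ j)) (v (σ j)) (N j))) ⟩
  ∑ l (λ j → α * term u j + β * term v j)   ≡⟨ ∑-+ l (λ j → α * term u j) (λ j → β * term v j) ⟩
  ∑ l (λ j → α * term u j) + ∑ l (λ j → β * term v j)
                                            ≡⟨ cong₂ _+_ (∑-*ˡ l α (term u)) (∑-*ˡ l β (term v)) ⟩
  α * ∑ l (term u) + β * ∑ l (term v)       ∎
  where
  l = suc (length ws)
  N : ℕ → ℚ
  N j = detRows ws (σ ∘ skip j)
  term : Row → ℕ → ℚ
  term s j = sign j * s (σ j) * N j
  distrib : ∀ s α β x y d → s * (α * x + β * y) * d ≡ α * (s * x * d) + β * (s * y * d)
  distrib = solve-∀ ring
detRows-linear σ (z ∷ zs) ws r u v α β e = begin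
  ∑ (len r) (term r)                        ≡⟨ ∑-cong (len r) (λ j _ → trans
                                                 (cong (sign j * z (σ j) *_) (detRows-linear (σ ∘ skip j) zs ws r u v α β e))
                                                 (distrib (sign j * z (σ j)) α β (N u j) (N v j))) ⟩
  ∑ (len r) (λ j → α * term u j + β * term v j)
                                            ≡⟨ ∑-+ (len r) (λ j → α * term u j) (λ j → β * term v j) ⟩
  ∑ (len r) (λ j → α * term u j) + ∑ (len r) (λ j → β * term v j)
                                            ≡⟨ cong₂ _+_ (∑-*ˡ (len r) α (term u)) (∑-*ˡ (len r) β (term v)) ⟩
  α * ∑ (len r) (term u) + β * ∑ (len r) (term v)
                                            ≡⟨ cong₂ (λ p q → α * ∑ (suc p) (term u) + β * ∑ (suc q) (term v))
                                                 (length-middle zs r u ws) (length-middle zs r v ws) ⟩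
  α * ∑ (len u) (term u) + β * ∑ (len v) (term v) ∎
  where
  len : Row → ℕ
  len s = suc (length (zs ++ s ∷ ws))
  N : Row → ℕ → ℚ
  N s j = detRows (zs ++ s ∷ ws) (σ ∘ skip j)
  term : Row → ℕ → ℚ
  term s j = sign j * z (σ j) * N s j
  distrib : ∀ s α β x y → s * (α * x + β * y) ≡ α * (s * x) + β * (s * y)
  distrib = solve-∀ ring

detRows-swap : ∀ σ zs x y ws → detRows (zs ++ x ∷ y ∷ ws) σ ≡ - detRows (zs ++ y ∷ x ∷ ws) σ
detRows-swap σ [] x y ws = begin
  detRows (x ∷ y ∷ ws) σ                       ≡⟨ double x y ⟩
  ∑ (suc l) (λ j → ∑ l (term x y j))           ≡⟨ ∑∑-antisym l (term x y) (term y x) (anti x y) (anti y x) ⟩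
  - ∑ (suc l) (λ j → ∑ l (term y x j))         ≡⟨ cong -_ (sym (double y x)) ⟩
  - detRows (y ∷ x ∷ ws) σ                     ∎
  where
  l = suc (length ws)
  inner : Row → ℕ → ℕ → ℚ
  inner y j i = sign i * y (σ (skip j i)) * detRows ws (σ ∘ skip j ∘ skip i)
  term : Row → Row → ℕ → ℕ → ℚ
  term x y j i = sign j * x (σ j) * inner y j i
  double : ∀ x y → detRows (x ∷ y ∷ ws) σ ≡ ∑ (suc l) (λ j → ∑ l (term x y j))
  double x y = ∑-cong (suc l) (λ j _ → sym (∑-*ˡ l (sign j * x (σ j)) (inner y j)))
  rearrange : ∀ s t a b d → (- s) * a * (t * b * d) ≡ - (t * b * (s * a * d))
  rearrange = solve-∀ ring
  anti : ∀ x y {j i} → j ≤ i → term x y (suc i) j ≡ - term y x j i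
  anti x y {j} {i} j≤i = begin
    sign (suc i) * x (σ (suc i)) * (sign j * y (σ (skip (suc i) j)) * detRows ws (σ ∘ skip (suc i) ∘ skip j))
      ≡⟨ cong₂ _*_ (cong₂ _*_ (sign-suc i) (cong (x ∘ σ) (sym (skip-≤ j≤i))))
           (cong₂ (λ p q → sign j * y (σ p) * q) (skip-> j≤i) (detRows-cols ws (λ c → cong σ (sym (skip-skip j≤i c))))) ⟩
    (- sign i) * x (σ (skip j i)) * (sign j * y (σ j) * detRows ws (σ ∘ skip j ∘ skip i))
      ≡⟨ rearrange (sign i) (sign j) (x (σ (skip j i))) (y (σ j)) (detRows ws (σ ∘ skip j ∘ skip i)) ⟩
    - term y x j i ∎
detRows-swap σ (z ∷ zs) x y ws = begin
  ∑ (len x y) (term x y)           ≡⟨ ∑-cong (len x y) (λ j _ → trans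
                                        (cong (sign j * z (σ j) *_) (detRows-swap (σ ∘ skip j) zs x y ws))
                                        (neg-out (sign j * z (σ j)) (N y x j))) ⟩
  ∑ (len x y) (λ j → - term y x j) ≡⟨ ∑-neg (len x y) (term y x) ⟩
  - ∑ (len x y) (term y x)         ≡⟨ cong (λ p → - ∑ (suc p) (term y x)) (trans (length-++ zs) (sym (length-++ zs))) ⟩
  - ∑ (len y x) (term y x)         ∎
  where
  len : Row → Row → ℕ
  len x y = suc (length (zs ++ x ∷ y ∷ ws))
  N : Row → Row → ℕ → ℚ
  N x y j = detRows (zs ++ x ∷ y ∷ ws) (σ ∘ skip j)
  term : Row → Row → ℕ → ℚ
  term x y j = sign j * z (σ j) * N x y j
  neg-out : ∀ a b → a * (- b) ≡ - (a * b)
  neg-out = solve-∀ ring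

detRows-alternating : ∀ σ → Alternating (λ rs → detRows rs σ)
detRows-alternating σ = record { linear = detRows-linear σ ; swap = detRows-swap σ }

under : ∀ {Φ} x → Alternating Φ → Alternating (Φ ∘ (x ∷_))
under x alt = record { linear = linear ∘ (x ∷_) ; swap = swap ∘ (x ∷_) }
  where open Alternating alt

move-to-front : ∀ {Φ} → Alternating Φ → ∀ xs y ws →
  Φ (xs ++ y ∷ ws) ≡ sign (length xs) * Φ (y ∷ xs ++ ws)
move-to-front         alt []       y ws = sym (*-identityˡ _)
move-to-front {Φ = Φ} alt (x ∷ xs) y ws = begin
  Φ (x ∷ xs ++ y ∷ ws)                          ≡⟨ move-to-front (under x alt) xs y ws ⟩
  sign (length xs) * Φ (x ∷ y ∷ xs ++ ws)       ≡⟨ cong (sign (length xs) *_) (Alternating.swap alt [] x y (xs ++ ws)) ⟩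
  sign (length xs) * - Φ (y ∷ x ∷ xs ++ ws)     ≡⟨ neg-across (sign (length xs)) _ ⟩
  - sign (length xs) * Φ (y ∷ x ∷ xs ++ ws)     ≡⟨ cong (_* Φ (y ∷ x ∷ xs ++ ws)) (sym (sign-suc (length xs))) ⟩
  sign (suc (length xs)) * Φ (y ∷ x ∷ xs ++ ws) ∎
  where
  neg-across : ∀ a b → a * (- b) ≡ (- a) * b
  neg-across = solve-∀ ring

rotate : ∀ {Φ} → Alternating Φ → ∀ xs ys →
  Φ (xs ++ ys) ≡ sign (length ys ℕ.* length xs) * Φ (ys ++ xs)
rotate {Φ = Φ} alt xs []       = trans (cong Φ (++-identityʳ xs)) (sym (*-identityˡ (Φ xs)))
rotate {Φ = Φ} alt xs (y ∷ ys) = begin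
  Φ (xs ++ y ∷ ys)                                               ≡⟨ move-to-front alt xs y ys ⟩
  sign (length xs) * Φ (y ∷ xs ++ ys)                            ≡⟨ cong (sign (length xs) *_) (rotate (under y alt) xs ys) ⟩
  sign (length xs) * (sign (length ys ℕ.* length xs) * Φ (y ∷ ys ++ xs))
                                                                 ≡⟨ sym (*-assoc (sign (length xs)) (sign (length ys ℕ.* length xs)) _) ⟩
  sign (length xs) * sign (length ys ℕ.* length xs) * Φ (y ∷ ys ++ xs)
                                                                 ≡⟨ cong (_* Φ (y ∷ ys ++ xs)) (sym (sign-+ (length xs) _)) ⟩
  sign (length xs ℕ.+ length ys ℕ.* length xs) * Φ (y ∷ ys ++ xs) ∎

repeated-row : ∀ {Φ} → Alternating Φ → ∀ {x ws} → x ∈ ws → Φ (x ∷ ws) ≡ 0ℚ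
repeated-row {Φ = Φ} alt {x} x∈ws with ∈-∃++ x∈ws
... | us , vs , refl = begin
  Φ (x ∷ us ++ x ∷ vs)                    ≡⟨ move-to-front (under x alt) us x vs ⟩
  sign (length us) * Φ (x ∷ x ∷ us ++ vs) ≡⟨ cong (sign (length us) *_) (self-neg⇒0 _ (Alternating.swap alt [] x x (us ++ vs))) ⟩
  sign (length us) * 0ℚ                   ≡⟨ *-zeroʳ (sign (length us)) ⟩
  0ℚ                                      ∎

reduce-rows : ∀ {Φ} → Alternating Φ → ∀ ν μ as {bs gs} →
  Pointwise (λ b g → ∃ λ u → ∃ λ v → u ∈ as × v ∈ as × (∀ c → μ * b c ≡ ν * (u c + v c) + - g c)) bs gs →
  μ ^ℕ length bs * Φ (bs ++ as) ≡ sign (length bs) * Φ (gs ++ as)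
reduce-rows         alt ν μ as []       = refl
reduce-rows {Φ = Φ} alt ν μ as {b ∷ bs} {g ∷ gs} ((u , v , u∈as , v∈as , e) ∷ es) = begin
  μ * M * Φ (b ∷ bs ++ as)                       ≡⟨ rot μ M _ ⟩
  M * (μ * Φ (b ∷ bs ++ as))                     ≡⟨ cong (M *_) head-row ⟩
  M * - Φ (g ∷ bs ++ as)                         ≡⟨ neg-out M _ ⟩
  - (M * Φ (g ∷ bs ++ as))                       ≡⟨ cong -_ (reduce-rows (under g alt) ν μ as es) ⟩
  - (sign (length bs) * Φ (g ∷ gs ++ as))        ≡⟨ neg-distribˡ-* (sign (length bs)) _ ⟩
  - sign (length bs) * Φ (g ∷ gs ++ as)          ≡⟨ cong (_* Φ (g ∷ gs ++ as)) (sym (sign-suc (length bs))) ⟩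
  sign (suc (length bs)) * Φ (g ∷ gs ++ as)      ∎
  where
  open Alternating alt
  M = μ ^ℕ length bs
  ws = bs ++ as
  rot : ∀ a b c → a * b * c ≡ b * (a * c)
  rot = solve-∀ ring
  neg-out : ∀ a b → a * (- b) ≡ - (a * b)
  neg-out = solve-∀ ring
  absorb : ∀ m x → m * x ≡ m * x + 0ℚ * x
  absorb = solve-∀ ring
  expand : ∀ n x y z → n * (x + y) + - z ≡ n * (x + y) + (- 1ℚ) * z
  expand = solve-∀ ring
  ones : ∀ x y → x + y ≡ 1ℚ * x + 1ℚ * y
  ones = solve-∀ ring
  collapse : ∀ n z → n * (1ℚ * 0ℚ + 1ℚ * 0ℚ) + (- 1ℚ) * z ≡ - z
  collapse = solve-∀ ring
  head-row : μ * Φ (b ∷ ws) ≡ - Φ (g ∷ ws)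
  head-row = begin
    μ * Φ (b ∷ ws)
      ≡⟨ absorb μ (Φ (b ∷ ws)) ⟩
    μ * Φ (b ∷ ws) + 0ℚ * Φ (b ∷ ws)
      ≡⟨ sym (linear [] ws (λ c → μ * b c) b b μ 0ℚ (λ c → absorb μ (b c))) ⟩
    Φ ((λ c → μ * b c) ∷ ws)
      ≡⟨ linear [] ws _ (λ c → u c + v c) g ν (- 1ℚ) (λ c → trans (e c) (expand ν (u c) (v c) (g c))) ⟩
    ν * Φ ((λ c → u c + v c) ∷ ws) + (- 1ℚ) * Φ (g ∷ ws)
      ≡⟨ cong (λ z → ν * z + (- 1ℚ) * Φ (g ∷ ws)) (linear [] ws _ u v 1ℚ 1ℚ (λ c → ones (u c) (v c))) ⟩
    ν * (1ℚ * Φ (u ∷ ws) + 1ℚ * Φ (v ∷ ws)) + (- 1ℚ) * Φ (g ∷ ws)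
      ≡⟨ cong₂ (λ p q → ν * (1ℚ * p + 1ℚ * q) + (- 1ℚ) * Φ (g ∷ ws))
           (repeated-row alt (∈-++⁺ʳ bs u∈as)) (repeated-row alt (∈-++⁺ʳ bs v∈as)) ⟩
    ν * (1ℚ * 0ℚ + 1ℚ * 0ℚ) + (- 1ℚ) * Φ (g ∷ ws)
      ≡⟨ collapse ν (Φ (g ∷ ws)) ⟩
    - Φ (g ∷ ws) ∎

-- Sylvester-type matrices

shift : Row → Row
shift r zero    = 0ℚ
shift r (suc c) = r c

shiftBy : ℕ → Row → Row
shiftBy zero    r = r
shiftBy (suc i) r = shift (shiftBy i r)

rows : Row → ℕ → List Row
rows r = applyUpTo (λ i → shiftBy i r)

length-rows : ∀ r m → length (rows r m) ≡ m
length-rows r = length-applyUpTo (λ i → shiftBy i r)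

shift-cong : ∀ {r s} → (∀ c → r c ≡ s c) → ∀ c → shift r c ≡ shift s c
shift-cong e zero    = refl
shift-cong e (suc c) = e c

shiftBy-shift : ∀ i r c → shiftBy i (shift r) c ≡ shift (shiftBy i r) c
shiftBy-shift zero    r c = refl
shiftBy-shift (suc i) r c = shift-cong (shiftBy-shift i r) c

shiftBy-vanish : ∀ {m r} → (∀ c → m ≤ c → r c ≡ 0ℚ) → ∀ i c → i ℕ.+ m ≤ c → shiftBy i r c ≡ 0ℚ
shiftBy-vanish h zero    c       m≤c       = h c m≤c
shiftBy-vanish h (suc i) (suc c) (s≤s m≤c) = shiftBy-vanish h i c m≤c

Pointwise-applyUpTo : ∀ {A : Set} {R : A → A → Set} (f g : ℕ → A) n →
  (∀ i → i < n → R (f i) (g i)) → Pointwise R (applyUpTo f n) (applyUpTo g n)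
Pointwise-applyUpTo f g zero    h = []
Pointwise-applyUpTo f g (suc n) h =
  h 0 (s≤s z≤n) ∷ Pointwise-applyUpTo (f ∘ suc) (g ∘ suc) n (λ i i<n → h (suc i) (s≤s i<n))

strip-leading-row : ∀ a b m l →
  detRows (rows a (suc m) ++ rows (shift b) l) id ≡ a 0 * detRows (rows a m ++ rows b l) id
strip-leading-row a b m l = trans
  (expand-first-column a _ id
    (AllP.++⁺ (AllP.applyUpTo⁺₂ _ m (λ _ → refl)) (AllP.applyUpTo⁺₂ _ l (λ i → shiftBy-shift i b 0))))
  (cong (a 0 *_) (detRows-cong
    (PW.++⁺ (Pointwise-applyUpTo _ _ m (λ _ _ _ → refl))
            (Pointwise-applyUpTo _ _ l (λ i _ c → shiftBy-shift i b (suc c))))))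

lower-triangular : ∀ a n → (∀ c → n < c → a c ≡ 0ℚ) → ∀ m →
  detRows (applyUpTo (λ i → shift (shiftBy i a)) m) (suc n ℕ.+_) ≡ a n ^ℕ m
lower-triangular a n h zero    = refl
lower-triangular a n h (suc m) = begin
  detRows (shift a ∷ rest) (suc n ℕ.+_)
    ≡⟨ block-triangular (shift a ∷ []) rest (suc n ℕ.+_) ((λ c → h (n ℕ.+ suc c) (ℕP.m<m+n n (s≤s z≤n))) ∷ []) ⟩
  (1ℚ * a (n ℕ.+ 0) * 1ℚ + 0ℚ) * detRows rest (λ c → suc n ℕ.+ suc c)
    ≡⟨ cong₂ _*_ (trans (unit (a (n ℕ.+ 0))) (cong a (ℕP.+-identityʳ n)))
         (trans (detRows-cong (Pointwise-applyUpTo _ _ m (λ i _ c → cong (shift (shiftBy i a)) (ℕP.+-suc n c))))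
                (lower-triangular a n h m)) ⟩
  a n * a n ^ℕ m ∎
  where
  rest = applyUpTo (λ i → shift (shift (shiftBy i a))) m
  unit : ∀ x → 1ℚ * x * 1ℚ + 0ℚ ≡ x
  unit = solve-∀ ring

sylvester-reduction : ∀ a b g ν μ n →
  (∀ c → μ * shift (shift b) c ≡ ν * (a c + shift a c) + - g c) →
  (∀ c → suc n < c → a c ≡ 0ℚ) → (∀ c → 2 ≤ c → g c ≡ 0ℚ) →
  μ ^ℕ suc n * (a 0 * (a 0 * detRows (rows a n ++ rows b (suc n)) id))
    ≡ detRows (a ∷ rows g (suc n)) id * a (suc n) ^ℕ suc n
sylvester-reduction a b g ν μ n rel a-vanish g-vanish = begin
  μ ^ℕ N * (a 0 * (a 0 * detRows (rows a n ++ rows b N) id))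
    ≡⟨ cong (λ z → μ ^ℕ N * (a 0 * z)) (sym (strip-leading-row a b n N)) ⟩
  μ ^ℕ N * (a 0 * detRows (rows a N ++ rows (shift b) N) id)
    ≡⟨ cong (μ ^ℕ N *_) (sym (strip-leading-row a (shift b) N N)) ⟩
  μ ^ℕ N * detRows (as ++ bs) id
    ≡⟨ cong (μ ^ℕ N *_) (trans (rotate alt as bs) (cong (_* detRows (bs ++ as) id) even-rotation)) ⟩
  μ ^ℕ N * (1ℚ * detRows (bs ++ as) id)
    ≡⟨ cong₂ (λ l z → μ ^ℕ l * z) (sym (length-rows (shift (shift b)) N)) (*-identityˡ _) ⟩
  μ ^ℕ length bs * detRows (bs ++ as) id
    ≡⟨ reduce-rows alt ν μ as (Pointwise-applyUpTo _ _ N (λ i i<N →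
         shiftBy i a , shiftBy (suc i) a , ∈-applyUpTo⁺ (λ i → shiftBy i a) (ℕP.m<n⇒m<1+n i<N) ,
         ∈-applyUpTo⁺ (λ i → shiftBy i a) (s≤s i<N) , shifted-rel i)) ⟩
  sign (length bs) * detRows (gs ++ as) id
    ≡⟨ cong₂ (λ l z → sign l * z) (trans (length-rows (shift (shift b)) N) (sym (length-rows g N)))
         (move-to-front alt gs a as′) ⟩
  sign (length gs) * (sign (length gs) * detRows (a ∷ gs ++ as′) id)
    ≡⟨ trans (sym (*-assoc (sign (length gs)) (sign (length gs)) (detRows (a ∷ gs ++ as′) id)))
         (trans (cong (_* detRows (a ∷ gs ++ as′) id) (sign-sq (length gs))) (*-identityˡ (detRows (a ∷ gs ++ as′) id))) ⟩
  detRows ((a ∷ gs) ++ as′) id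
    ≡⟨ block-triangular (a ∷ gs) as′ id (All.map (λ h c → h (suc (length gs ℕ.+ c))
         (s≤s (subst (ℕ._≤ length gs ℕ.+ c) (length-rows g N) (ℕP.m≤m+n (length gs) c)))) top-vanish) ⟩
  detRows (a ∷ gs) id * detRows as′ (λ c → suc (length gs) ℕ.+ c)
    ≡⟨ cong (λ l → detRows (a ∷ gs) id * detRows as′ (λ c → suc l ℕ.+ c)) (length-rows g N) ⟩
  detRows (a ∷ gs) id * detRows as′ (suc N ℕ.+_)
    ≡⟨ cong (detRows (a ∷ gs) id *_) (lower-triangular a N a-vanish N) ⟩
  detRows (a ∷ gs) id * a N ^ℕ N ∎
  where
  N = suc n
  as = rows a (suc N)
  as′ = applyUpTo (λ i → shift (shiftBy i a)) N
  bs = rows (shift (shift b)) N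
  gs = rows g N
  alt = detRows-alternating id
  top-vanish : All (λ r → ∀ c → N < c → r c ≡ 0ℚ) (a ∷ gs)
  top-vanish = a-vanish ∷ AllP.applyUpTo⁺₁ (λ i → shiftBy i g) N (λ {i} i<N c N<c → shiftBy-vanish g-vanish i c
    (ℕP.≤-trans (subst (ℕ._≤ suc N) (ℕP.+-comm 2 i) (s≤s i<N)) N<c))
  even-rotation : sign (length bs ℕ.* length as) ≡ 1ℚ
  even-rotation = trans
    (cong sign (trans (cong₂ ℕ._*_ (length-rows (shift (shift b)) N) (length-rows a (suc N))) (ℕP.*-comm N (suc N))))
    (sign-pronic N)
  shifted-rel : ∀ i c → μ * shiftBy i (shift (shift b)) c ≡ ν * (shiftBy i a c + shiftBy (suc i) a c) + - shiftBy i g c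
  shifted-rel zero    c       = rel c
  shifted-rel (suc i) zero    = zeros ν μ
    where
    zeros : ∀ ν μ → μ * 0ℚ ≡ ν * (0ℚ + 0ℚ) + - 0ℚ
    zeros = solve-∀ ring
  shifted-rel (suc i) (suc c) = shifted-rel i c

-- Evaluation as a determinant with linear divisor rows

module _ (g : Row) (g-vanish : ∀ c → 2 ≤ c → g c ≡ 0ℚ) where

  bidiagMinor : ℕ → ℕ → ℚ
  bidiagMinor n j = detRows (rows g n) (skip j)

  bidiagMinor-zero : ∀ n → bidiagMinor (suc n) 0 ≡ g 1 * bidiagMinor n 0
  bidiagMinor-zero n = begin
    detRows (g ∷ rest) suc
      ≡⟨ block-triangular (g ∷ []) rest suc ((λ c → g-vanish (2 ℕ.+ c) (s≤s (s≤s z≤n))) ∷ []) ⟩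
    (1ℚ * g 1 * 1ℚ + 0ℚ) * detRows rest (λ c → suc (suc c))
      ≡⟨ cong₂ _*_ (unit (g 1)) (detRows-cong (Pointwise-applyUpTo _ _ n (λ _ _ _ → refl))) ⟩
    g 1 * bidiagMinor n 0 ∎
    where
    rest = applyUpTo (λ i → shift (shiftBy i g)) n
    unit : ∀ x → 1ℚ * x * 1ℚ + 0ℚ ≡ x
    unit = solve-∀ ring

  bidiagMinor-suc : ∀ n j → bidiagMinor (suc n) (suc j) ≡ g 0 * bidiagMinor n j
  bidiagMinor-suc n j = trans
    (expand-first-column g _ (skip (suc j)) (AllP.applyUpTo⁺₂ _ n (λ _ → refl)))
    (cong (g 0 *_) (detRows-cong (Pointwise-applyUpTo _ _ n (λ _ _ _ → refl))))

  bidiagMinor-step : ∀ n j → j ≤ n → bidiagMinor (suc n) j ≡ g 1 * bidiagMinor n j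
  bidiagMinor-step n       zero    _         = bidiagMinor-zero n
  bidiagMinor-step (suc n) (suc j) (s≤s j≤n) = begin
    bidiagMinor (suc (suc n)) (suc j)   ≡⟨ bidiagMinor-suc (suc n) j ⟩
    g 0 * bidiagMinor (suc n) j         ≡⟨ cong (g 0 *_) (bidiagMinor-step n j j≤n) ⟩
    g 0 * (g 1 * bidiagMinor n j)       ≡⟨ exchange (g 0) (g 1) _ ⟩
    g 1 * (g 0 * bidiagMinor n j)       ≡⟨ cong (g 1 *_) (sym (bidiagMinor-suc n j)) ⟩
    g 1 * bidiagMinor (suc n) (suc j)   ∎
    where
    exchange : ∀ a b c → a * (b * c) ≡ b * (a * c)
    exchange = solve-∀ ring

  bidiagMinor-diag : ∀ n → bidiagMinor n n ≡ g 0 ^ℕ n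
  bidiagMinor-diag zero    = refl
  bidiagMinor-diag (suc n) = trans (bidiagMinor-suc n n) (cong (g 0 *_) (bidiagMinor-diag n))

  bordered : ℕ → Row → ℚ
  bordered n f = ∑ (suc n) (λ j → sign j * f j * bidiagMinor n j)

  detRows-bordered : ∀ n f → detRows (f ∷ rows g n) id ≡ bordered n f
  detRows-bordered n f = cong (λ l → ∑ (suc l) (λ j → sign j * f j * bidiagMinor n j)) (length-rows g n)

  bordered-cong : ∀ n {f h} → (∀ j → j ≤ n → f j ≡ h j) → bordered n f ≡ bordered n h
  bordered-cong n e = ∑-cong (suc n) (λ j j≤n → cong (λ x → sign j * x * bidiagMinor n j) (e j (ℕP.≤-pred j≤n)))

  bordered-step : ∀ n f → bordered (suc n) f ≡ g 1 * bordered n f + sign (suc n) * f (suc n) * g 0 ^ℕ suc n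
  bordered-step n f = trans
    (∑-snoc (suc n) (λ j → sign j * f j * bidiagMinor (suc n) j))
    (cong₂ _+_
      (trans (∑-cong (suc n) (λ j j≤n → trans (cong (sign j * f j *_) (bidiagMinor-step n j (ℕP.≤-pred j≤n)))
                                              (exchange (sign j * f j) (g 1) (bidiagMinor n j))))
             (∑-*ˡ (suc n) (g 1) (λ j → sign j * f j * bidiagMinor n j)))
      (cong (sign (suc n) * f (suc n) *_) (bidiagMinor-diag (suc n))))
    where
    exchange : ∀ a b c → a * (b * c) ≡ b * (a * c)
    exchange = solve-∀ ring

-- Coefficients of p from degree d downwards
reversed : Poly → ℕ → Row
reversed p zero    zero    = coeff p 0
reversed p zero    (suc c) = 0ℚ
reversed p (suc d) zero    = coeff p (suc d)
reversed p (suc d) (suc c) = reversed p d c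

reversed-head : ∀ p d → reversed p d 0 ≡ coeff p d
reversed-head p zero    = refl
reversed-head p (suc d) = refl

reversed-last : ∀ p d → reversed p d d ≡ coeff p 0
reversed-last p zero    = refl
reversed-last p (suc d) = reversed-last p d

reversed-vanish : ∀ p d c → d < c → reversed p d c ≡ 0ℚ
reversed-vanish p zero    (suc c) _         = refl
reversed-vanish p (suc d) (suc c) (s≤s d<c) = reversed-vanish p d c d<c

reversed-cons : ∀ a p d c → c ≤ d → reversed (a ∷ p) (suc d) c ≡ reversed p d c
reversed-cons a p zero    zero    _         = refl
reversed-cons a p (suc d) zero    _         = refl
reversed-cons a p (suc d) (suc c) (s≤s c≤d) = reversed-cons a p d c c≤d

reversed-[] : ∀ d c → reversed [] d c ≡ 0ℚ
reversed-[] zero    zero    = refl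
reversed-[] zero    (suc c) = refl
reversed-[] (suc d) zero    = refl
reversed-[] (suc d) (suc c) = reversed-[] d c

eval-zero : ∀ p x → p ≈ₚ [] → eval p x ≡ 0ℚ
eval-zero []      x z = refl
eval-zero (a ∷ p) x z = trans (cong₂ (λ u v → u + x * v) (z 0) (eval-zero p x (z ∘ suc))) (zeros x)
  where
  zeros : ∀ x → 0ℚ + x * 0ℚ ≡ 0ℚ
  zeros = solve-∀ ring

bordered-eval : ∀ g (g-vanish : ∀ c → 2 ≤ c → g c ≡ 0ℚ) x → g 1 ≡ - (x * g 0) →
  ∀ n p → DegLe p n → bordered g g-vanish n (reversed p n) ≡ sign n * g 0 ^ℕ n * eval p x
bordered-eval g gv x e n [] _ = trans
  (∑-zero (suc n) (λ j → sign j * reversed [] n j * bidiagMinor g gv n j) (λ j _ →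
    trans (cong (λ y → sign j * y * bidiagMinor g gv n j) (reversed-[] n j)) (kill (sign j) (bidiagMinor g gv n j))))
  (sym (*-zeroʳ (sign n * g 0 ^ℕ n)))
  where
  kill : ∀ a b → a * 0ℚ * b ≡ 0ℚ
  kill = solve-∀ ring
bordered-eval g gv x e zero (a ∷ p) dp = begin
  1ℚ * a * 1ℚ + 0ℚ                   ≡⟨ simplify a x ⟩
  1ℚ * 1ℚ * (a + x * 0ℚ)             ≡⟨ cong (λ z → 1ℚ * 1ℚ * (a + x * z)) (sym (eval-zero p x (λ i → dp (suc i) (s≤s z≤n)))) ⟩
  1ℚ * 1ℚ * (a + x * eval p x)       ∎
  where
  simplify : ∀ a x → 1ℚ * a * 1ℚ + 0ℚ ≡ 1ℚ * 1ℚ * (a + x * 0ℚ)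
  simplify = solve-∀ ring
bordered-eval g gv x e (suc n) (a ∷ p) dp = begin
  bordered g gv (suc n) (reversed (a ∷ p) (suc n))
    ≡⟨ bordered-step g gv n (reversed (a ∷ p) (suc n)) ⟩
  g 1 * bordered g gv n (reversed (a ∷ p) (suc n)) + sign (suc n) * reversed (a ∷ p) (suc n) (suc n) * g 0 ^ℕ suc n
    ≡⟨ cong₂ _+_
        (cong₂ _*_ e (trans (bordered-cong g gv n (λ j j≤n → reversed-cons a p n j j≤n))
                            (bordered-eval g gv x e n p (λ i n<i → dp (suc i) (s≤s n<i)))))
        (cong₂ (λ s c → s * c * g 0 ^ℕ suc n) (sign-suc n) (reversed-last (a ∷ p) (suc n))) ⟩
  - (x * g 0) * (sign n * g 0 ^ℕ n * eval p x) + - sign n * a * (g 0 * g 0 ^ℕ n)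
    ≡⟨ horner x (g 0) (sign n) (g 0 ^ℕ n) (eval p x) a ⟩
  - sign n * (g 0 * g 0 ^ℕ n) * (a + x * eval p x)
    ≡⟨ cong (λ s → s * (g 0 * g 0 ^ℕ n) * (a + x * eval p x)) (sym (sign-suc n)) ⟩
  sign (suc n) * (g 0 * g 0 ^ℕ n) * (a + x * eval p x) ∎
  where
  horner : ∀ x d s q v a → - (x * d) * (s * q * v) + - s * a * (d * q) ≡ - s * (d * q) * (a + x * v)
  horner = solve-∀ ring

-- Resultants in terms of rows

applyUpTo-++ : ∀ {A : Set} (f : ℕ → A) m n →
  applyUpTo f (m ℕ.+ n) ≡ applyUpTo f m ++ applyUpTo (λ i → f (m ℕ.+ i)) n
applyUpTo-++ f zero    n = refl
applyUpTo-++ f (suc m) n = cong (f 0 ∷_) (applyUpTo-++ (f ∘ suc) m n)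

reversed-coeff : ∀ p d c → c ≤ d → reversed p d c ≡ coeff p (d ∸ c)
reversed-coeff p zero    zero    _         = refl
reversed-coeff p (suc d) zero    _         = refl
reversed-coeff p (suc d) (suc c) (s≤s c≤d) = reversed-coeff p d c c≤d

shiftBy-< : ∀ s r j → j < s → shiftBy s r j ≡ 0ℚ
shiftBy-< (suc s) r zero    _         = refl
shiftBy-< (suc s) r (suc j) (s≤s j<s) = shiftBy-< s r j j<s

shiftBy-≥ : ∀ s r j → s ≤ j → shiftBy s r j ≡ r (j ∸ s)
shiftBy-≥ zero    r j       _         = refl
shiftBy-≥ (suc s) r (suc j) (s≤s s≤j) = shiftBy-≥ s r j s≤j

sylEntry-row : ∀ f d s j → sylEntry f d s j ≡ shiftBy s (reversed f d) j
sylEntry-row f d s j with s ℕ.≤? j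
... | no  s≰j = sym (shiftBy-< s (reversed f d) j (ℕP.≰⇒> s≰j))
... | yes s≤j with (j ∸ s) ℕ.≤? d
...   | yes le = sym (trans (shiftBy-≥ s (reversed f d) j s≤j) (reversed-coeff f d (j ∸ s) le))
...   | no  gt = sym (trans (shiftBy-≥ s (reversed f d) j s≤j) (reversed-vanish f d (j ∸ s) (ℕP.≰⇒> gt)))

resultant-rows : ∀ f g {d e} → degree f ≡ d → degree g ≡ e →
  resultant f g ≡ detRows (rows (reversed f d) e ++ rows (reversed g e) d) id
resultant-rows f g refl refl = begin
  det (d ℕ.+ e) (sylvester f g)
    ≡⟨ det≡detRows (d ℕ.+ e) S id entry ⟩
  detRows (applyUpTo S (d ℕ.+ e)) id
    ≡⟨ cong (λ l → detRows l id) (trans (cong (applyUpTo S) (ℕP.+-comm d e)) (applyUpTo-++ S e d)) ⟩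
  detRows (applyUpTo S e ++ applyUpTo (λ i → S (e ℕ.+ i)) d) id
    ≡⟨ detRows-cong (PW.++⁺ (Pointwise-applyUpTo _ _ e top) (Pointwise-applyUpTo _ _ d bottom)) ⟩
  detRows (rows (reversed f d) e ++ rows (reversed g e) d) id ∎
  where
  d = degree f
  e = degree g
  S : ℕ → Row
  S i with i ℕ.<? e
  ... | yes _ = sylEntry f d i
  ... | no  _ = sylEntry g e (i ∸ e)
  entry : ∀ i j → sylvester f g i j ≡ S (toℕ i) (toℕ j)
  entry i j with toℕ i ℕ.<? e
  ... | yes _ = refl
  ... | no  _ = refl
  top : ∀ i → i < e → SameOn id id (S i) (shiftBy i (reversed f d))
  top i i<e c with i ℕ.<? e
  ... | yes _   = sylEntry-row f d i c
  ... | no  i≮e = ⊥-elim (i≮e i<e)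
  bottom : ∀ i → i < d → SameOn id id (S (e ℕ.+ i)) (shiftBy i (reversed g e))
  bottom i _ c with (e ℕ.+ i) ℕ.<? e
  ... | yes lt = ⊥-elim (ℕP.m+n≮m e i lt)
  ... | no  _  = trans (cong (λ s → sylEntry g e s c) (ℕP.m+n∸m≡n e i)) (sylEntry-row g e i c)

isZeroPoly-true : ∀ p → p ≈ₚ [] → isZeroPoly p ≡ true
isZeroPoly-true []      z = refl
isZeroPoly-true (a ∷ p) z with a ≟ 0ℚ
... | yes _ = isZeroPoly-true p (z ∘ suc)
... | no ne = ⊥-elim (ne (z 0))

isZeroPoly-false : ∀ p i → coeff p i ≢ 0ℚ → isZeroPoly p ≡ false
isZeroPoly-false []      i       ne = ⊥-elim (ne refl)
isZeroPoly-false (a ∷ p) i       ne with a ≟ 0ℚ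
isZeroPoly-false (a ∷ p) zero    ne | yes e = ⊥-elim (ne e)
isZeroPoly-false (a ∷ p) (suc i) ne | yes _ = isZeroPoly-false p i ne
isZeroPoly-false (a ∷ p) i       ne | no _  = refl

degree-unique : ∀ p d → DegLe p d → coeff p d ≢ 0ℚ → degree p ≡ d
degree-unique []      d       _  ne = ⊥-elim (ne refl)
degree-unique (a ∷ p) zero    dp ne
  rewrite isZeroPoly-true p (λ i → dp (suc i) (s≤s z≤n)) = refl
degree-unique (a ∷ p) (suc d) dp ne
  rewrite isZeroPoly-false p d ne = cong suc (degree-unique p d (λ i d<i → dp (suc i) (s≤s d<i)) ne)

-- Polynomial arithmetic

coeff-+ₚ : ∀ p q i → coeff (p +ₚ q) i ≡ coeff p i + coeff q i
coeff-+ₚ []      q       i       = sym (+-identityˡ (coeff q i))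
coeff-+ₚ (a ∷ p) []      i       = sym (+-identityʳ (coeff (a ∷ p) i))
coeff-+ₚ (a ∷ p) (b ∷ q) zero    = refl
coeff-+ₚ (a ∷ p) (b ∷ q) (suc i) = coeff-+ₚ p q i

coeff-·ₚ : ∀ c p i → coeff (c ·ₚ p) i ≡ c * coeff p i
coeff-·ₚ c []      i       = sym (*-zeroʳ c)
coeff-·ₚ c (a ∷ p) zero    = refl
coeff-·ₚ c (a ∷ p) (suc i) = coeff-·ₚ c p i

coeff-x* : ∀ p i → coeff (0ℚ ∷ p) i ≡ shift (coeff p) i
coeff-x* p zero    = refl
coeff-x* p (suc i) = refl

coeff-∷*ₚ : ∀ a p q i → coeff ((a ∷ p) *ₚ q) i ≡ a * coeff q i + shift (coeff (p *ₚ q)) i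
coeff-∷*ₚ a p q i = trans (coeff-+ₚ (a ·ₚ q) (0ℚ ∷ p *ₚ q) i)
  (cong₂ _+_ (coeff-·ₚ a q i) (coeff-x* (p *ₚ q) i))

coeff-linear* : ∀ a b q i → coeff ((a ∷ b ∷ []) *ₚ q) i ≡ a * coeff q i + b * shift (coeff q) i
coeff-linear* a b q i = trans (coeff-∷*ₚ a (b ∷ []) q i) (cong (λ z → a * coeff q i + z) (inner i))
  where
  inner : ∀ i → shift (coeff ((b ∷ []) *ₚ q)) i ≡ b * shift (coeff q) i
  inner zero    = sym (*-zeroʳ b)
  inner (suc i) = trans (coeff-∷*ₚ b [] q i) (trans (cong (λ z → b * coeff q i + z) (zeros i)) (+-identityʳ (b * coeff q i)))
    where
    zeros : ∀ i → shift (coeff ([] *ₚ q)) i ≡ 0ℚ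
    zeros zero    = refl
    zeros (suc i) = refl

coeff-*-linear* : ∀ p a b q i →
  coeff (p *ₚ ((a ∷ b ∷ []) *ₚ q)) i ≡ a * coeff (p *ₚ q) i + b * shift (coeff (p *ₚ q)) i
coeff-*-linear* []      a b q i = sym (trans (cong (λ z → a * 0ℚ + b * z) (zeros i)) (zero-sum a b))
  where
  zeros : ∀ i → shift (coeff []) i ≡ 0ℚ
  zeros zero    = refl
  zeros (suc i) = refl
  zero-sum : ∀ a b → a * 0ℚ + b * 0ℚ ≡ 0ℚ
  zero-sum = solve-∀ ring
coeff-*-linear* (c ∷ p) a b q i = begin
  coeff ((c ∷ p) *ₚ uq) i
    ≡⟨ coeff-∷*ₚ c p uq i ⟩
  c * coeff uq i + shift (coeff (p *ₚ uq)) i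
    ≡⟨ cong₂ (λ y z → c * y + z) (coeff-linear* a b q i) (shifted i) ⟩
  c * (a * coeff q i + b * shift (coeff q) i) + (a * shift pq i + b * shift (shift pq) i)
    ≡⟨ regroup a b c (coeff q i) (shift (coeff q) i) (shift pq i) (shift (shift pq) i) ⟩
  a * (c * coeff q i + shift pq i) + b * (c * shift (coeff q) i + shift (shift pq) i)
    ≡⟨ sym (cong₂ (λ y z → a * y + b * z) (coeff-∷*ₚ c p q i) (shifted-product i)) ⟩
  a * coeff ((c ∷ p) *ₚ q) i + b * shift (coeff ((c ∷ p) *ₚ q)) i ∎
  where
  uq = (a ∷ b ∷ []) *ₚ q
  pq = coeff (p *ₚ q)
  regroup : ∀ a b c w x y z → c * (a * w + b * x) + (a * y + b * z) ≡ a * (c * w + y) + b * (c * x + z)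
  regroup = solve-∀ ring
  zero-sum : ∀ a b → 0ℚ ≡ a * 0ℚ + b * 0ℚ
  zero-sum = solve-∀ ring
  shifted : ∀ i → shift (coeff (p *ₚ uq)) i ≡ a * shift pq i + b * shift (shift pq) i
  shifted zero    = zero-sum a b
  shifted (suc i) = coeff-*-linear* p a b q i
  shifted-product : ∀ i → shift (coeff ((c ∷ p) *ₚ q)) i ≡ c * shift (coeff q) i + shift (shift pq) i
  shifted-product zero    = zero-one c
    where
    zero-one : ∀ c → 0ℚ ≡ c * 0ℚ + 0ℚ
    zero-one = solve-∀ ring
  shifted-product (suc i) = coeff-∷*ₚ c p q i

coeff-*-one : ∀ p i → coeff (p *ₚ oneₚ) i ≡ coeff p i
coeff-*-one []      i = refl
coeff-*-one (a ∷ p) i = trans (coeff-∷*ₚ a p oneₚ i) (cases i)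
  where
  simplify : ∀ a → a * 1ℚ + 0ℚ ≡ a
  simplify = solve-∀ ring
  drop-zero : ∀ a b → a * 0ℚ + b ≡ b
  drop-zero = solve-∀ ring
  cases : ∀ i → a * coeff oneₚ i + shift (coeff (p *ₚ oneₚ)) i ≡ coeff (a ∷ p) i
  cases zero    = simplify a
  cases (suc i) = trans (drop-zero a (coeff (p *ₚ oneₚ) i)) (coeff-*-one p i)

coeff-*-x^ : ∀ p s i → i < s → coeff (p *ₚ (xₚ ^ₚ s)) i ≡ 0ℚ
coeff-*-x^ p (suc s) i i<s = trans (coeff-*-linear* p 0ℚ 1ℚ (xₚ ^ₚ s) i) 
  (trans (simplify (coeff (p *ₚ (xₚ ^ₚ s)) i) (shift (coeff (p *ₚ (xₚ ^ₚ s))) i)) (shifted i i<s))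
  where
  simplify : ∀ u v → 0ℚ * u + 1ℚ * v ≡ v
  simplify = solve-∀ ring
  shifted : ∀ i → i < suc s → shift (coeff (p *ₚ (xₚ ^ₚ s))) i ≡ 0ℚ
  shifted zero    _         = refl
  shifted (suc i) (s≤s i<s) = coeff-*-x^ p s i i<s

eval-+ₚ : ∀ p q x → eval (p +ₚ q) x ≡ eval p x + eval q x
eval-+ₚ []      q       x = sym (+-identityˡ (eval q x))
eval-+ₚ (a ∷ p) []      x = sym (+-identityʳ (eval (a ∷ p) x))
eval-+ₚ (a ∷ p) (b ∷ q) x = trans (cong (λ z → a + b + x * z) (eval-+ₚ p q x)) (regroup a b x (eval p x) (eval q x))
  where
  regroup : ∀ a b x u v → a + b + x * (u + v) ≡ a + x * u + (b + x * v)
  regroup = solve-∀ ring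

eval-·ₚ : ∀ c p x → eval (c ·ₚ p) x ≡ c * eval p x
eval-·ₚ c []      x = sym (*-zeroʳ c)
eval-·ₚ c (a ∷ p) x = trans (cong (λ z → c * a + x * z) (eval-·ₚ c p x)) (regroup c a x (eval p x))
  where
  regroup : ∀ c a x u → c * a + x * (c * u) ≡ c * (a + x * u)
  regroup = solve-∀ ring

eval-cong : ∀ p q x → p ≈ₚ q → eval p x ≡ eval q x
eval-cong []      q       x e = sym (eval-zero q x (λ i → sym (e i)))
eval-cong (a ∷ p) []      x e = eval-zero (a ∷ p) x e
eval-cong (a ∷ p) (b ∷ q) x e = cong₂ (λ u v → u + x * v) (e 0) (eval-cong p q x (e ∘ suc))

-- Naming the private helper of deriv: abstracting the starting index lets unification solve for it.
mutual
  derivFrom : ℕ → Poly → Poly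
  derivFrom = _

  deriv-∷ : ∀ a p → deriv (a ∷ p) ≡ derivFrom 1 p
  deriv-∷ a p with 1
  ... | _ = refl

coeff-derivFrom : ∀ s p i → coeff (derivFrom s p) i ≡ fromℕℚ (s ℕ.+ i) * coeff p i
coeff-derivFrom s []      i       = sym (*-zeroʳ (fromℕℚ (s ℕ.+ i)))
coeff-derivFrom s (a ∷ p) zero    = cong (λ z → fromℕℚ z * a) (sym (ℕP.+-identityʳ s))
coeff-derivFrom s (a ∷ p) (suc i) = trans (coeff-derivFrom (suc s) p i)
  (cong (λ z → fromℕℚ z * coeff p i) (sym (ℕP.+-suc s i)))

coeff-deriv : ∀ p i → coeff (deriv p) i ≡ fromℕℚ (suc i) * coeff p (suc i)
coeff-deriv []      i = sym (*-zeroʳ (fromℕℚ (suc i)))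
coeff-deriv (a ∷ p) i = trans (cong (λ q → coeff q i) (deriv-∷ a p)) (coeff-derivFrom 1 p i)

-- Natural numbers and inverses in ℚ

toℚᵘ-fromℕℚ : ∀ n → toℚᵘ (fromℕℚ n) ℚᵘ.≃ mkℚᵘ (+ n) 0
toℚᵘ-fromℕℚ n = toℚᵘ-fromℚᵘ (mkℚᵘ (+ n) 0)

fromℕℚ-+ : ∀ m n → fromℕℚ (m ℕ.+ n) ≡ fromℕℚ m + fromℕℚ n
fromℕℚ-+ m n = toℚᵘ-injective (begin≃
  toℚᵘ (fromℕℚ (m ℕ.+ n))                       ≈⟨ toℚᵘ-fromℕℚ (m ℕ.+ n) ⟩
  mkℚᵘ (+ (m ℕ.+ n)) 0                           ≈⟨ *≡* (cong (ℤ._* (+ 1)) (cong₂ ℤ._+_ (sym (ℤP.*-identityʳ (+ m))) (sym (ℤP.*-identityʳ (+ n))))) ⟩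
  mkℚᵘ (+ m) 0 ℚᵘ.+ mkℚᵘ (+ n) 0                 ≈⟨ ℚᵘP.≃-sym (ℚᵘP.+-cong (toℚᵘ-fromℕℚ m) (toℚᵘ-fromℕℚ n)) ⟩
  toℚᵘ (fromℕℚ m) ℚᵘ.+ toℚᵘ (fromℕℚ n)           ≈⟨ ℚᵘP.≃-sym (toℚᵘ-homo-+ (fromℕℚ m) (fromℕℚ n)) ⟩
  toℚᵘ (fromℕℚ m + fromℕℚ n)                     ∎≃)
  where open ℚᵘP.≃-Reasoning renaming (begin_ to begin≃_; _∎ to _∎≃)

fromℕℚ-* : ∀ m n → fromℕℚ (m ℕ.* n) ≡ fromℕℚ m * fromℕℚ n
fromℕℚ-* m n = toℚᵘ-injective (begin≃
  toℚᵘ (fromℕℚ (m ℕ.* n))                       ≈⟨ toℚᵘ-fromℕℚ (m ℕ.* n) ⟩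
  mkℚᵘ (+ (m ℕ.* n)) 0                           ≈⟨ *≡* (cong (ℤ._* (+ 1)) (ℤP.pos-* m n)) ⟩
  mkℚᵘ (+ m) 0 ℚᵘ.* mkℚᵘ (+ n) 0                 ≈⟨ ℚᵘP.≃-sym (ℚᵘP.*-cong (toℚᵘ-fromℕℚ m) (toℚᵘ-fromℕℚ n)) ⟩
  toℚᵘ (fromℕℚ m) ℚᵘ.* toℚᵘ (fromℕℚ n)           ≈⟨ ℚᵘP.≃-sym (toℚᵘ-homo-* (fromℕℚ m) (fromℕℚ n)) ⟩
  toℚᵘ (fromℕℚ m * fromℕℚ n)                     ∎≃)
  where open ℚᵘP.≃-Reasoning renaming (begin_ to begin≃_; _∎ to _∎≃)

fromℕℚ≢0 : ∀ n → 0 < n → fromℕℚ n ≢ 0ℚ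
fromℕℚ≢0 (suc n) _ e with ℚᵘP.≃-trans (ℚᵘP.≃-sym (toℚᵘ-fromℕℚ (suc n))) (ℚᵘP.≃-reflexive (cong toℚᵘ e))
... | *≡* ()

factorial≢0 : ∀ n → fromℕℚ (n !) ≢ 0ℚ
factorial≢0 n = fromℕℚ≢0 (n !) (ℕP.1≤n! n)

*-inv : ∀ {x} → x ≢ 0ℚ → x * inv x ≡ 1ℚ
*-inv {x} ne with x ≟ 0ℚ
... | yes e  = ⊥-elim (ne e)
... | no ne′ = *-inverseʳ x {{≢-nonZero ne′}}

*-cancelˡ : ∀ {c x y} → c ≢ 0ℚ → c * x ≡ c * y → x ≡ y
*-cancelˡ {c} {x} {y} ne e = begin
  x                 ≡⟨ unit x ⟩
  x * 1ℚ            ≡⟨ cong (x *_) (sym (*-inv ne)) ⟩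
  x * (c * inv c)   ≡⟨ rot x c (inv c) ⟩
  inv c * (c * x)   ≡⟨ cong (inv c *_) e ⟩
  inv c * (c * y)   ≡⟨ sym (rot y c (inv c)) ⟩
  y * (c * inv c)   ≡⟨ cong (y *_) (*-inv ne) ⟩
  y * 1ℚ            ≡⟨ sym (unit y) ⟩
  y                 ∎
  where
  unit : ∀ x → x ≡ x * 1ℚ
  unit = solve-∀ ring
  rot : ∀ x c i → x * (c * i) ≡ i * (c * x)
  rot = solve-∀ ring

*-nonzero : ∀ {x y} → x ≢ 0ℚ → y ≢ 0ℚ → x * y ≢ 0ℚ
*-nonzero {x} {y} nx ny e = ny (*-cancelˡ nx (trans e (sym (*-zeroʳ x))))

÷'-* : ∀ {x y} → y ≢ 0ℚ → y * (x ÷' y) ≡ x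
÷'-* {x} {y} ne = trans (rot y x (inv y)) (trans (cong (x *_) (*-inv ne)) (*-identityʳ x))
  where
  rot : ∀ y x i → y * (x * i) ≡ x * (y * i)
  rot = solve-∀ ring

^ℕ-nonzero : ∀ {x} n → x ≢ 0ℚ → x ^ℕ n ≢ 0ℚ
^ℕ-nonzero zero    ne = λ ()
^ℕ-nonzero (suc n) ne = *-nonzero ne (^ℕ-nonzero n ne)

^ℕ-* : ∀ x y n → (x * y) ^ℕ n ≡ x ^ℕ n * y ^ℕ n
^ℕ-* x y zero    = refl
^ℕ-* x y (suc n) = trans (cong (x * y *_) (^ℕ-* x y n)) (regroup x y (x ^ℕ n) (y ^ℕ n))
  where
  regroup : ∀ x y u v → x * y * (u * v) ≡ x * u * (y * v)
  regroup = solve-∀ ring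

-- The coefficients of Q_m and of its derivatives

-- Coefficients of the power series (1 + x)⁻ˢ
negPower : ℕ → ℕ → ℚ
negPower zero    i       = coeff oneₚ i
negPower (suc s) zero    = negPower s zero
negPower (suc s) (suc i) = negPower s (suc i) + - negPower (suc s) i

negPower-head : ∀ s → negPower s 0 ≡ 1ℚ
negPower-head zero    = refl
negPower-head (suc s) = negPower-head s

fromℕℚ-! : ∀ n → fromℕℚ (suc n !) ≡ fromℕℚ (suc n) * fromℕℚ (n !)
fromℕℚ-! n = fromℕℚ-* (suc n) (n !)

negPower-factorial : ∀ s i → fromℕℚ (s !) * fromℕℚ (i !) * negPower (suc s) i ≡ sign i * fromℕℚ ((s ℕ.+ i) !)
negPower-factorial s zero = begin
  fromℕℚ (s !) * 1ℚ * negPower s 0   ≡⟨ cong (fromℕℚ (s !) * 1ℚ *_) (negPower-head s) ⟩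
  fromℕℚ (s !) * 1ℚ * 1ℚ             ≡⟨ ones (fromℕℚ (s !)) ⟩
  1ℚ * fromℕℚ (s !)                  ≡⟨ cong (λ z → 1ℚ * fromℕℚ (z !)) (sym (ℕP.+-identityʳ s)) ⟩
  1ℚ * fromℕℚ ((s ℕ.+ 0) !)          ∎
  where
  ones : ∀ x → x * 1ℚ * 1ℚ ≡ 1ℚ * x
  ones = solve-∀ ring
negPower-factorial zero (suc i) = begin
  1ℚ * fromℕℚ (suc i !) * (0ℚ + - negPower 1 i)
    ≡⟨ cong (λ z → 1ℚ * z * (0ℚ + - negPower 1 i)) (fromℕℚ-! i) ⟩
  1ℚ * (fromℕℚ (suc i) * fromℕℚ (i !)) * (0ℚ + - negPower 1 i)
    ≡⟨ regroup (fromℕℚ (suc i)) (fromℕℚ (i !)) (negPower 1 i) ⟩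
  - (fromℕℚ (suc i) * (1ℚ * fromℕℚ (i !) * negPower 1 i))
    ≡⟨ cong (λ z → - (fromℕℚ (suc i) * z)) (negPower-factorial 0 i) ⟩
  - (fromℕℚ (suc i) * (sign i * fromℕℚ (i !)))
    ≡⟨ regroup′ (fromℕℚ (suc i)) (sign i) (fromℕℚ (i !)) ⟩
  - sign i * (fromℕℚ (suc i) * fromℕℚ (i !))
    ≡⟨ cong₂ _*_ (sym (sign-suc i)) (sym (fromℕℚ-! i)) ⟩
  sign (suc i) * fromℕℚ (suc i !) ∎
  where
  regroup : ∀ a b c → 1ℚ * (a * b) * (0ℚ + - c) ≡ - (a * (1ℚ * b * c))
  regroup = solve-∀ ring
  regroup′ : ∀ a b c → - (a * (b * c)) ≡ - b * (a * c)
  regroup′ = solve-∀ ring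
negPower-factorial (suc s) (suc i) = begin
  fromℕℚ (suc s !) * fromℕℚ (suc i !) * (T + - U)
    ≡⟨ distrib (fromℕℚ (suc s !)) (fromℕℚ (suc i !)) T U ⟩
  fromℕℚ (suc s !) * fromℕℚ (suc i !) * T + - (fromℕℚ (suc s !) * fromℕℚ (suc i !) * U)
    ≡⟨ cong₂ (λ y z → y * fromℕℚ (suc i !) * T + - (fromℕℚ (suc s !) * z * U)) (fromℕℚ-! s) (fromℕℚ-! i) ⟩
  fromℕℚ (suc s) * fromℕℚ (s !) * fromℕℚ (suc i !) * T + - (fromℕℚ (suc s !) * (fromℕℚ (suc i) * fromℕℚ (i !)) * U)
    ≡⟨ regroup (fromℕℚ (suc s)) (fromℕℚ (s !)) (fromℕℚ (suc i !)) T (fromℕℚ (suc s !)) (fromℕℚ (suc i)) (fromℕℚ (i !)) U ⟩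
  fromℕℚ (suc s) * (fromℕℚ (s !) * fromℕℚ (suc i !) * T) + - (fromℕℚ (suc i) * (fromℕℚ (suc s !) * fromℕℚ (i !) * U))
    ≡⟨ cong₂ (λ y z → fromℕℚ (suc s) * y + - (fromℕℚ (suc i) * z)) (negPower-factorial s (suc i))
         (trans (negPower-factorial (suc s) i) (cong (λ z → sign i * fromℕℚ (z !)) (sym (ℕP.+-suc s i)))) ⟩
  fromℕℚ (suc s) * (sign (suc i) * w) + - (fromℕℚ (suc i) * (sign i * w))
    ≡⟨ cong (λ z → fromℕℚ (suc s) * (z * w) + - (fromℕℚ (suc i) * (sign i * w))) (sign-suc i) ⟩
  fromℕℚ (suc s) * (- sign i * w) + - (fromℕℚ (suc i) * (sign i * w))
    ≡⟨ collect (fromℕℚ (suc s)) (fromℕℚ (suc i)) (sign i) w ⟩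
  - sign i * ((fromℕℚ (suc s) + fromℕℚ (suc i)) * w)
    ≡⟨ cong₂ (λ y z → y * (z * w)) (sym (sign-suc i)) (sym (fromℕℚ-+ (suc s) (suc i))) ⟩
  sign (suc i) * (fromℕℚ (suc s ℕ.+ suc i) * w)
    ≡⟨ cong (sign (suc i) *_) (sym (fromℕℚ-! (s ℕ.+ suc i))) ⟩
  sign (suc i) * fromℕℚ ((suc s ℕ.+ suc i) !) ∎
  where
  T = negPower (suc s) (suc i)
  U = negPower (suc (suc s)) i
  w = fromℕℚ ((s ℕ.+ suc i) !)
  distrib : ∀ a b t u → a * b * (t + - u) ≡ a * b * t + - (a * b * u)
  distrib = solve-∀ ring
  regroup : ∀ a b c t d e f u → a * b * c * t + - (d * (e * f) * u) ≡ a * (b * c * t) + - (e * (d * f * u))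
  regroup = solve-∀ ring
  collect : ∀ a b s w → a * (- s * w) + - (b * (s * w)) ≡ - s * ((a + b) * w)
  collect = solve-∀ ring

negPower-unique : ∀ Q m s r → (∀ i → i ≤ m → coeff (Q *ₚ (x+1ₚ ^ₚ s)) i ≡ negPower r i) →
  ∀ i → i ≤ m → coeff Q i ≡ negPower (s ℕ.+ r) i
negPower-unique Q m zero    r h i i≤m = trans (sym (coeff-*-one Q i)) (h i i≤m)
negPower-unique Q m (suc s) r h i i≤m = trans (negPower-unique Q m s (suc r) divide i i≤m)
  (cong (λ z → negPower z i) (ℕP.+-suc s r))
  where
  q : ℕ → ℚ
  q = coeff (Q *ₚ (x+1ₚ ^ₚ s))
  ones : ∀ u v → 1ℚ * u + 1ℚ * v ≡ u + v
  ones = solve-∀ ring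
  multiplied : ∀ i → i ≤ m → q i + shift q i ≡ negPower r i
  multiplied i i≤m = trans (sym (trans (coeff-*-linear* Q 1ℚ 1ℚ (x+1ₚ ^ₚ s) i) (ones (q i) (shift q i)))) (h i i≤m)
  isolate : ∀ x y → x ≡ x + y + - y
  isolate = solve-∀ ring
  divide : ∀ i → i ≤ m → q i ≡ negPower (suc r) i
  divide zero    i≤m = trans (sym (+-identityʳ (q 0))) (multiplied 0 i≤m)
  divide (suc i) i≤m = trans (isolate (q (suc i)) (q i))
    (cong₂ (λ u v → u + - v) (multiplied (suc i) i≤m) (divide i (ℕP.≤-trans (ℕP.n≤1+n i) i≤m)))

Q-coeff : ∀ m P Q → IsPQ m P Q → ∀ i → i ≤ m →
  fromℕℚ (m !) * fromℕℚ (i !) * coeff Q i ≡ sign i * fromℕℚ ((m ℕ.+ i) !)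
Q-coeff m P Q (_ , _ , identity) i i≤m = trans
  (cong (fromℕℚ (m !) * fromℕℚ (i !) *_) (trans (negPower-unique Q m (suc m) 0 truncated i i≤m)
    (cong (λ z → negPower z i) (ℕP.+-identityʳ (suc m)))))
  (negPower-factorial m i)
  where
  truncated : ∀ i → i ≤ m → coeff (Q *ₚ (x+1ₚ ^ₚ suc m)) i ≡ coeff oneₚ i
  truncated i i≤m = begin
    coeff (Q *ₚ (x+1ₚ ^ₚ suc m)) i
      ≡⟨ sym (+-identityˡ (coeff (Q *ₚ (x+1ₚ ^ₚ suc m)) i)) ⟩
    0ℚ + coeff (Q *ₚ (x+1ₚ ^ₚ suc m)) i
      ≡⟨ cong (λ z → z + coeff (Q *ₚ (x+1ₚ ^ₚ suc m)) i) (sym (coeff-*-x^ P (suc m) i (s≤s i≤m))) ⟩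
    coeff (P *ₚ (xₚ ^ₚ suc m)) i + coeff (Q *ₚ (x+1ₚ ^ₚ suc m)) i
      ≡⟨ sym (coeff-+ₚ (P *ₚ (xₚ ^ₚ suc m)) (Q *ₚ (x+1ₚ ^ₚ suc m)) i) ⟩
    coeff (P *ₚ (xₚ ^ₚ suc m) +ₚ Q *ₚ (x+1ₚ ^ₚ suc m)) i
      ≡⟨ identity i ⟩
    coeff oneₚ i ∎

coeff-derivN : ∀ k p i → fromℕℚ (i !) * coeff (derivN k p) i ≡ fromℕℚ ((i ℕ.+ k) !) * coeff p (i ℕ.+ k)
coeff-derivN zero    p i = cong (λ z → fromℕℚ (z !) * coeff p z) (sym (ℕP.+-identityʳ i))
coeff-derivN (suc k) p i = begin
  fromℕℚ (i !) * coeff (deriv (derivN k p)) i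
    ≡⟨ cong (fromℕℚ (i !) *_) (coeff-deriv (derivN k p) i) ⟩
  fromℕℚ (i !) * (fromℕℚ (suc i) * coeff (derivN k p) (suc i))
    ≡⟨ regroup (fromℕℚ (i !)) (fromℕℚ (suc i)) (coeff (derivN k p) (suc i)) ⟩
  fromℕℚ (suc i) * fromℕℚ (i !) * coeff (derivN k p) (suc i)
    ≡⟨ cong (_* coeff (derivN k p) (suc i)) (sym (fromℕℚ-! i)) ⟩
  fromℕℚ (suc i !) * coeff (derivN k p) (suc i)
    ≡⟨ coeff-derivN k p (suc i) ⟩
  fromℕℚ ((suc i ℕ.+ k) !) * coeff p (suc i ℕ.+ k)
    ≡⟨ cong (λ z → fromℕℚ (z !) * coeff p z) (sym (ℕP.+-suc i k)) ⟩
  fromℕℚ ((i ℕ.+ suc k) !) * coeff p (i ℕ.+ suc k) ∎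
  where
  regroup : ∀ a b c → a * (b * c) ≡ b * a * c
  regroup = solve-∀ ring

derivN-degree : ∀ k p d → DegLe p (d ℕ.+ k) → DegLe (derivN k p) d
derivN-degree k p d dp i d<i = *-cancelˡ (factorial≢0 i) (begin
  fromℕℚ (i !) * coeff (derivN k p) i                ≡⟨ coeff-derivN k p i ⟩
  fromℕℚ ((i ℕ.+ k) !) * coeff p (i ℕ.+ k)           ≡⟨ cong (fromℕℚ ((i ℕ.+ k) !) *_) (dp (i ℕ.+ k) (ℕP.+-monoˡ-< k d<i)) ⟩
  fromℕℚ ((i ℕ.+ k) !) * 0ℚ                          ≡⟨ *-zeroʳ (fromℕℚ ((i ℕ.+ k) !)) ⟩
  0ℚ                                                 ≡⟨ sym (*-zeroʳ (fromℕℚ (i !))) ⟩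
  fromℕℚ (i !) * 0ℚ                                  ∎)

Q-derivN-coeff : ∀ k d P Q → IsPQ (d ℕ.+ k) P Q → ∀ i → i ≤ d →
  fromℕℚ ((d ℕ.+ k) !) * fromℕℚ (i !) * coeff (derivN k Q) i
    ≡ sign (i ℕ.+ k) * fromℕℚ ((d ℕ.+ k ℕ.+ (i ℕ.+ k)) !)
Q-derivN-coeff k d P Q pq i i≤d = begin
  fromℕℚ ((d ℕ.+ k) !) * fromℕℚ (i !) * coeff (derivN k Q) i
    ≡⟨ *-assoc (fromℕℚ ((d ℕ.+ k) !)) (fromℕℚ (i !)) (coeff (derivN k Q) i) ⟩
  fromℕℚ ((d ℕ.+ k) !) * (fromℕℚ (i !) * coeff (derivN k Q) i)
    ≡⟨ cong (fromℕℚ ((d ℕ.+ k) !) *_) (coeff-derivN k Q i) ⟩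
  fromℕℚ ((d ℕ.+ k) !) * (fromℕℚ ((i ℕ.+ k) !) * coeff Q (i ℕ.+ k))
    ≡⟨ sym (*-assoc (fromℕℚ ((d ℕ.+ k) !)) (fromℕℚ ((i ℕ.+ k) !)) (coeff Q (i ℕ.+ k))) ⟩
  fromℕℚ ((d ℕ.+ k) !) * fromℕℚ ((i ℕ.+ k) !) * coeff Q (i ℕ.+ k)
    ≡⟨ Q-coeff (d ℕ.+ k) P Q pq (i ℕ.+ k) (ℕP.+-monoˡ-≤ k i≤d) ⟩
  sign (i ℕ.+ k) * fromℕℚ ((d ℕ.+ k ℕ.+ (i ℕ.+ k)) !) ∎

sign≢0 : ∀ n → sign n ≢ 0ℚ
sign≢0 n e with trans (sym (sign-sq n)) (cong (_* sign n) e)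
... | eq = 1≢0 (trans eq (*-zeroˡ (sign n)))
  where
  1≢0 : 1ℚ ≢ 0ℚ
  1≢0 ()

sign-^ : ∀ n m → sign n ^ℕ m ≡ sign (m ℕ.* n)
sign-^ n zero    = refl
sign-^ n (suc m) = trans (cong (sign n *_) (sign-^ n m)) (sym (sign-+ n (m ℕ.* n)))

^ℤ-minus-two : ∀ {x} n → x ≢ 0ℚ → x * (x * x ^ℤ ((+ suc n) ℤ.- (+ 2))) ≡ x ^ℕ suc n
^ℤ-minus-two {x} zero    ne = begin
  x * (x * inv (x * 1ℚ))        ≡⟨ regroup x (inv (x * 1ℚ)) ⟩
  x * (x * 1ℚ * inv (x * 1ℚ))   ≡⟨ cong (x *_) (*-inv (*-nonzero ne (λ ()))) ⟩
  x * 1ℚ                        ∎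
  where
  regroup : ∀ x y → x * (x * y) ≡ x * (x * 1ℚ * y)
  regroup = solve-∀ ring
^ℤ-minus-two (suc n) ne = refl

timesX^ : ℕ → Poly → Poly
timesX^ zero    p = p
timesX^ (suc n) p = 0ℚ ∷ timesX^ n p

coeff-timesX^-< : ∀ n p i → i < n → coeff (timesX^ n p) i ≡ 0ℚ
coeff-timesX^-< (suc n) p zero    _         = refl
coeff-timesX^-< (suc n) p (suc i) (s≤s i<n) = coeff-timesX^-< n p i i<n

coeff-timesX^-+ : ∀ n p i → coeff (timesX^ n p) (n ℕ.+ i) ≡ coeff p i
coeff-timesX^-+ zero    p i = refl
coeff-timesX^-+ (suc n) p i = coeff-timesX^-+ n p i

eval-timesX^ : ∀ n p x → eval p x ≡ 0ℚ → eval (timesX^ n p) x ≡ 0ℚ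
eval-timesX^ zero    p x e = e
eval-timesX^ (suc n) p x e = trans (cong (λ z → 0ℚ + x * z) (eval-timesX^ n p x e)) (zeros x)
  where
  zeros : ∀ x → 0ℚ + x * 0ℚ ≡ 0ℚ
  zeros = solve-∀ ring

module Consecutive (k N : ℕ) (Pa Qa Pb Qb : Poly)
  (pqa : IsPQ (suc N ℕ.+ k) Pa Qa) (pqb : IsPQ (N ℕ.+ k) Pb Qb) where

  n = suc N
  A = derivN k Qa
  B = derivN k Qb
  α = coeff A
  β = coeff B
  ν = fromℕℚ (n ℕ.+ k)
  μ = fromℕℚ (suc (N ℕ.+ k ℕ.+ k))
  X = fromℕℚ ((N ℕ.+ k) !)

  A-deg : DegLe A n
  A-deg = derivN-degree k Qa n (proj₁ (proj₂ pqa))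

  B-deg : DegLe B N
  B-deg = derivN-degree k Qb N (proj₁ (proj₂ pqb))

  α-coeff : ∀ i → i ≤ n →
    ν * X * fromℕℚ (i !) * α i ≡ sign (i ℕ.+ k) * fromℕℚ ((n ℕ.+ k ℕ.+ (i ℕ.+ k)) !)
  α-coeff i i≤n = trans (cong (λ z → z * fromℕℚ (i !) * α i) (sym (fromℕℚ-! (N ℕ.+ k))))
                        (Q-derivN-coeff k n Pa Qa pqa i i≤n)

  β-coeff : ∀ i → i ≤ N →
    X * fromℕℚ (i !) * β i ≡ sign (i ℕ.+ k) * fromℕℚ ((N ℕ.+ k ℕ.+ (i ℕ.+ k)) !)
  β-coeff = Q-derivN-coeff k N Pb Qb pqb

  α-pair : ∀ i → i ≤ N → X * fromℕℚ (suc i !) * (ν * (α (suc i) + α i))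
    ≡ μ * (sign (suc i ℕ.+ k) * fromℕℚ ((N ℕ.+ k ℕ.+ (suc i ℕ.+ k)) !))
  α-pair i i≤N = begin
    X * fromℕℚ (suc i !) * (ν * (α (suc i) + α i))
      ≡⟨ distrib X (fromℕℚ (suc i !)) ν (α (suc i)) (α i) ⟩
    ν * X * fromℕℚ (suc i !) * α (suc i) + ν * X * fromℕℚ (suc i !) * α i
      ≡⟨ cong (λ z → ν * X * fromℕℚ (suc i !) * α (suc i) + ν * X * z * α i) (fromℕℚ-! i) ⟩
    ν * X * fromℕℚ (suc i !) * α (suc i) + ν * X * (j * fromℕℚ (i !)) * α i
      ≡⟨ cong₂ _+_ (α-coeff (suc i) (s≤s i≤N)) (rot (ν * X) j (fromℕℚ (i !)) (α i)) ⟩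
    s * fromℕℚ (suc W !) + j * (ν * X * fromℕℚ (i !) * α i)
      ≡⟨ cong₂ (λ y z → s * y + j * z) (fromℕℚ-! W) (α-coeff i (ℕP.≤-trans i≤N (ℕP.n≤1+n N))) ⟩
    s * (fromℕℚ (suc W) * w) + j * (sign (i ℕ.+ k) * fromℕℚ (suc (N ℕ.+ k ℕ.+ (i ℕ.+ k)) !))
      ≡⟨ cong₂ (λ y z → s * (y * w) + j * z)
           (trans (cong fromℕℚ (split-W N k i)) (fromℕℚ-+ (suc i) (suc (N ℕ.+ k ℕ.+ k))))
           (cong₂ (λ y z → y * fromℕℚ (z !)) (trans (neg-neg (sign (i ℕ.+ k))) (cong -_ (sym (sign-suc (i ℕ.+ k)))))
             (sym (ℕP.+-suc (N ℕ.+ k) (i ℕ.+ k)))) ⟩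
    s * ((j + μ) * w) + j * (- s * w)
      ≡⟨ collect s j μ w ⟩
    μ * (s * w) ∎
    where
    W = N ℕ.+ k ℕ.+ (suc i ℕ.+ k)
    w = fromℕℚ (W !)
    j = fromℕℚ (suc i)
    s = sign (suc i ℕ.+ k)
    split-W : ∀ N k i → suc (N ℕ.+ k ℕ.+ (suc i ℕ.+ k)) ≡ suc i ℕ.+ suc (N ℕ.+ k ℕ.+ k)
    split-W = solveℕ-∀
    distrib : ∀ x f v a b → x * f * (v * (a + b)) ≡ v * x * f * a + v * x * f * b
    distrib = solve-∀ ring
    rot : ∀ x j f a → x * (j * f) * a ≡ j * (x * f * a)
    rot = solve-∀ ring
    neg-neg : ∀ x → x ≡ - (- x)
    neg-neg = solve-∀ ring
    collect : ∀ s j m w → s * ((j + m) * w) + j * (- s * w) ≡ m * (s * w)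
    collect = solve-∀ ring

  X≢0 : X ≢ 0ℚ
  X≢0 = factorial≢0 (N ℕ.+ k)

  μ≢0 : μ ≢ 0ℚ
  μ≢0 = fromℕℚ≢0 (suc (N ℕ.+ k ℕ.+ k)) (s≤s z≤n)

  exchange : ∀ a b c → a * (b * c) ≡ b * (a * c)
  exchange = solve-∀ ring

  contiguous-zero : ν * α 0 ≡ μ * β 0
  contiguous-zero = *-cancelˡ (*-nonzero X≢0 (factorial≢0 0)) (begin
    X * fromℕℚ (0 !) * (ν * α 0)                             ≡⟨ regroup X (fromℕℚ (0 !)) ν (α 0) ⟩
    ν * X * fromℕℚ (0 !) * α 0                               ≡⟨ α-coeff 0 z≤n ⟩
    sign k * fromℕℚ (suc (N ℕ.+ k ℕ.+ k) !)                  ≡⟨ cong (sign k *_) (fromℕℚ-! (N ℕ.+ k ℕ.+ k)) ⟩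
    sign k * (μ * fromℕℚ ((N ℕ.+ k ℕ.+ k) !))                ≡⟨ exchange (sign k) μ _ ⟩
    μ * (sign k * fromℕℚ ((N ℕ.+ k ℕ.+ k) !))                ≡⟨ cong (μ *_) (sym (β-coeff 0 z≤n)) ⟩
    μ * (X * fromℕℚ (0 !) * β 0)                             ≡⟨ exchange μ (X * fromℕℚ (0 !)) (β 0) ⟩
    X * fromℕℚ (0 !) * (μ * β 0)                             ∎)
    where
    regroup : ∀ x f v a → x * f * (v * a) ≡ v * x * f * a
    regroup = solve-∀ ring

  contiguous-suc : ∀ i → suc i ≤ N → ν * (α (suc i) + α i) ≡ μ * β (suc i)
  contiguous-suc i i<N = *-cancelˡ (*-nonzero X≢0 (factorial≢0 (suc i))) (begin
    X * fromℕℚ (suc i !) * (ν * (α (suc i) + α i))           ≡⟨ α-pair i (ℕP.≤-trans (ℕP.n≤1+n i) i<N) ⟩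
    μ * (sign (suc i ℕ.+ k) * fromℕℚ ((N ℕ.+ k ℕ.+ (suc i ℕ.+ k)) !))
                                                             ≡⟨ cong (μ *_) (sym (β-coeff (suc i) i<N)) ⟩
    μ * (X * fromℕℚ (suc i !) * β (suc i))                   ≡⟨ exchange μ (X * fromℕℚ (suc i !)) (β (suc i)) ⟩
    X * fromℕℚ (suc i !) * (μ * β (suc i))                   ∎)

  -- (n + k)(1 + x)A − (n + 2k)B = xⁿ(c + d x)
  c d : ℚ
  c = ν * (α n + α N)
  d = ν * α n

  τ : ℚ
  τ = fromℕℚ (2 ℕ.* (n ℕ.+ k))

  τc≡μd : τ * c ≡ μ * d
  τc≡μd = *-cancelˡ (*-nonzero X≢0 (factorial≢0 n)) (begin
    Y * (τ * c)                         ≡⟨ exchange Y τ c ⟩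
    τ * (Y * c)                         ≡⟨ cong (τ *_) (α-pair N ℕP.≤-refl) ⟩
    τ * (μ * (s * w))                   ≡⟨ regroup τ μ s w ⟩
    μ * (s * (τ * w))                   ≡⟨ cong (λ z → μ * (s * (fromℕℚ z * w))) (twice N k) ⟩
    μ * (s * (fromℕℚ (suc W) * w))      ≡⟨ cong (λ z → μ * (s * z)) (sym (fromℕℚ-! W)) ⟩
    μ * (s * fromℕℚ (suc W !))          ≡⟨ cong (μ *_) (sym (α-coeff n ℕP.≤-refl)) ⟩
    μ * (ν * X * fromℕℚ (n !) * α n)    ≡⟨ regroup′ μ ν X (fromℕℚ (n !)) (α n) ⟩
    Y * (μ * d)                         ∎)
    where
    Y = X * fromℕℚ (n !)
    W = N ℕ.+ k ℕ.+ (n ℕ.+ k)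
    w = fromℕℚ (W !)
    s = sign (n ℕ.+ k)
    twice : ∀ N k → 2 ℕ.* (suc N ℕ.+ k) ≡ suc (N ℕ.+ k ℕ.+ (suc N ℕ.+ k))
    twice = solveℕ-∀
    regroup : ∀ t m s w → t * (m * (s * w)) ≡ m * (s * (t * w))
    regroup = solve-∀ ring
    regroup′ : ∀ m v x f a → m * (v * x * f * a) ≡ x * f * (m * (v * a))
    regroup′ = solve-∀ ring

  x₀ : ℚ
  x₀ = - (μ ÷' τ)

  τ≢0 : τ ≢ 0ℚ
  τ≢0 = fromℕℚ≢0 (2 ℕ.* (n ℕ.+ k)) (s≤s z≤n)

  τx₀≡-μ : τ * x₀ ≡ - μ
  τx₀≡-μ = trans (neg-out τ (μ ÷' τ)) (cong -_ (÷'-* τ≢0))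
    where
    neg-out : ∀ a b → a * (- b) ≡ - (a * b)
    neg-out = solve-∀ ring

  c≡-x₀d : c ≡ - (x₀ * d)
  c≡-x₀d = *-cancelˡ τ≢0 (begin
    τ * c                ≡⟨ τc≡μd ⟩
    μ * d                ≡⟨ neg-neg μ d ⟩
    - (- μ * d)          ≡⟨ cong (λ z → - (z * d)) (sym τx₀≡-μ) ⟩
    - (τ * x₀ * d)       ≡⟨ regroup τ x₀ d ⟩
    τ * - (x₀ * d)       ∎)
    where
    neg-neg : ∀ m d → m * d ≡ - (- m * d)
    neg-neg = solve-∀ ring
    regroup : ∀ t x d → - (t * x * d) ≡ t * - (x * d)
    regroup = solve-∀ ring

  remainder : Row
  remainder zero          = d
  remainder (suc zero)    = c
  remainder (suc (suc _)) = 0ℚ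

  remainder-vanish : ∀ j → 2 ≤ j → remainder j ≡ 0ℚ
  remainder-vanish (suc (suc j)) _ = refl
  remainder-vanish (suc zero) (s≤s ())

  reversed-contiguous : ∀ e → e ≤ N → ∀ i →
    μ * reversed B e i ≡ ν * (reversed A e (suc i) + reversed A e i)
  reversed-contiguous zero    _   zero    =
    trans (sym contiguous-zero) (cong (ν *_) (sym (+-identityˡ (α 0))))
  reversed-contiguous zero    _   (suc i) = zeros μ ν
    where
    zeros : ∀ m v → m * 0ℚ ≡ v * (0ℚ + 0ℚ)
    zeros = solve-∀ ring
  reversed-contiguous (suc e) e<N zero    = trans (sym (contiguous-suc e e<N))
    (cong (ν *_) (trans (+-comm (α (suc e)) (α e)) (cong (λ z → z + α (suc e)) (sym (reversed-head A e)))))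
  reversed-contiguous (suc e) e<N (suc i) = reversed-contiguous e (ℕP.≤-trans (ℕP.n≤1+n e) e<N) i

  row-relation : ∀ j → μ * shift (shift (reversed B N)) j
    ≡ ν * (reversed A n j + shift (reversed A n) j) + - remainder j
  row-relation zero          = cancel μ ν (α n)
    where
    cancel : ∀ m v a → m * 0ℚ ≡ v * (a + 0ℚ) + - (v * a)
    cancel = solve-∀ ring
  row-relation (suc zero)    = trans (cancel μ ν (α n) (α N))
    (cong (λ z → ν * (z + α n) + - c) (sym (reversed-head A N)))
    where
    cancel : ∀ m v a b → m * 0ℚ ≡ v * (b + a) + - (v * (a + b))
    cancel = solve-∀ ring
  row-relation (suc (suc i)) = trans (reversed-contiguous N ℕP.≤-refl i)
    (sym (+-identityʳ (ν * (reversed A N (suc i) + reversed A N i))))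

  poly-relation : (ν ·ₚ (A +ₚ (0ℚ ∷ A))) ≈ₚ (μ ·ₚ B +ₚ timesX^ n (c ∷ d ∷ []))
  poly-relation i = begin
    coeff (ν ·ₚ (A +ₚ (0ℚ ∷ A))) i
      ≡⟨ coeff-·ₚ ν (A +ₚ (0ℚ ∷ A)) i ⟩
    ν * coeff (A +ₚ (0ℚ ∷ A)) i
      ≡⟨ cong (ν *_) (trans (coeff-+ₚ A (0ℚ ∷ A) i) (cong (λ z → α i + z) (coeff-x* A i))) ⟩
    ν * (α i + shift α i)
      ≡⟨ cases i ⟩
    μ * β i + coeff (timesX^ n (c ∷ d ∷ [])) i
      ≡⟨ cong (λ z → z + coeff (timesX^ n (c ∷ d ∷ [])) i) (sym (coeff-·ₚ μ B i)) ⟩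
    coeff (μ ·ₚ B) i + coeff (timesX^ n (c ∷ d ∷ [])) i
      ≡⟨ sym (coeff-+ₚ (μ ·ₚ B) (timesX^ n (c ∷ d ∷ [])) i) ⟩
    coeff (μ ·ₚ B +ₚ timesX^ n (c ∷ d ∷ [])) i ∎
    where
    drop-zero : ∀ m x → x ≡ m * 0ℚ + x
    drop-zero = solve-∀ ring
    beyond : ∀ e → ν * (α (suc (suc N ℕ.+ e)) + α (suc N ℕ.+ e)) ≡ coeff (d ∷ []) e
    beyond zero    rewrite ℕP.+-identityʳ N =
      cong (ν *_) (trans (cong (λ z → z + α n) (A-deg (suc n) ℕP.≤-refl)) (+-identityˡ (α n)))
    beyond (suc e) = trans
      (cong₂ (λ y z → ν * (y + z)) (A-deg (suc (n ℕ.+ suc e)) (s≤s (ℕP.m≤m+n n (suc e))))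
                                   (A-deg (n ℕ.+ suc e) (ℕP.m<m+n n (s≤s z≤n))))
      (*-zeroʳ ν)
    cases : ∀ i → ν * (α i + shift α i) ≡ μ * β i + coeff (timesX^ n (c ∷ d ∷ [])) i
    cases zero = trans (cong (ν *_) (+-identityʳ (α 0))) (trans contiguous-zero (sym (+-identityʳ (μ * β 0))))
    cases (suc j) with ℕP.<-cmp j N
    ... | tri< j<N _ _ = begin
      ν * (α (suc j) + α j)                             ≡⟨ contiguous-suc j j<N ⟩
      μ * β (suc j)                                     ≡⟨ sym (+-identityʳ (μ * β (suc j))) ⟩
      μ * β (suc j) + 0ℚ                                ≡⟨ cong (λ z → μ * β (suc j) + z) (sym (coeff-timesX^-< N (c ∷ d ∷ []) j j<N)) ⟩
      μ * β (suc j) + coeff (timesX^ N (c ∷ d ∷ [])) j  ∎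
    ... | tri≈ _ refl _ = begin
      c                                                 ≡⟨ drop-zero μ c ⟩
      μ * 0ℚ + c                                        ≡⟨ cong₂ (λ y z → μ * y + z) (sym (B-deg (suc N) ℕP.≤-refl))
                                                             (sym (trans (cong (coeff (timesX^ N (c ∷ d ∷ []))) (sym (ℕP.+-identityʳ N)))
                                                                         (coeff-timesX^-+ N (c ∷ d ∷ []) 0))) ⟩
      μ * β (suc N) + coeff (timesX^ N (c ∷ d ∷ [])) N  ∎
    ... | tri> _ _ N<j with ℕP.m≤n⇒∃[o]m+o≡n N<j
    ...   | e , refl = begin
      ν * (α (suc (suc N ℕ.+ e)) + α (suc N ℕ.+ e))     ≡⟨ beyond e ⟩
      coeff (d ∷ []) e                                  ≡⟨ drop-zero μ (coeff (d ∷ []) e) ⟩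
      μ * 0ℚ + coeff (d ∷ []) e                         ≡⟨ cong₂ (λ y z → μ * y + z)
                                                             (sym (B-deg (suc (suc N ℕ.+ e)) (s≤s (ℕP.≤-trans (ℕP.m≤m+n N e) (ℕP.n≤1+n (N ℕ.+ e))))))
                                                             (sym (trans (cong (coeff (timesX^ N (c ∷ d ∷ []))) (sym (ℕP.+-suc N e)))
                                                                         (coeff-timesX^-+ N (c ∷ d ∷ []) (suc e)))) ⟩
      μ * β (suc (suc N ℕ.+ e)) + coeff (timesX^ N (c ∷ d ∷ [])) (suc N ℕ.+ e) ∎

  eval-relation : ν * (eval A x₀ + x₀ * eval A x₀) ≡ μ * eval B x₀
  eval-relation = begin
    ν * (eval A x₀ + x₀ * eval A x₀)
      ≡⟨ cong (λ z → ν * (eval A x₀ + z)) (sym (+-identityˡ (x₀ * eval A x₀))) ⟩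
    ν * (eval A x₀ + (0ℚ + x₀ * eval A x₀))
      ≡⟨ cong (ν *_) (sym (eval-+ₚ A (0ℚ ∷ A) x₀)) ⟩
    ν * eval (A +ₚ (0ℚ ∷ A)) x₀
      ≡⟨ sym (eval-·ₚ ν (A +ₚ (0ℚ ∷ A)) x₀) ⟩
    eval (ν ·ₚ (A +ₚ (0ℚ ∷ A))) x₀
      ≡⟨ eval-cong (ν ·ₚ (A +ₚ (0ℚ ∷ A))) (μ ·ₚ B +ₚ timesX^ n (c ∷ d ∷ [])) x₀ poly-relation ⟩
    eval (μ ·ₚ B +ₚ timesX^ n (c ∷ d ∷ [])) x₀
      ≡⟨ eval-+ₚ (μ ·ₚ B) (timesX^ n (c ∷ d ∷ [])) x₀ ⟩
    eval (μ ·ₚ B) x₀ + eval (timesX^ n (c ∷ d ∷ [])) x₀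
      ≡⟨ cong₂ _+_ (eval-·ₚ μ B x₀) (eval-timesX^ n (c ∷ d ∷ []) x₀ root) ⟩
    μ * eval B x₀ + 0ℚ
      ≡⟨ +-identityʳ (μ * eval B x₀) ⟩
    μ * eval B x₀ ∎
    where
    cancel : ∀ x d → - (x * d) + x * (d + x * 0ℚ) ≡ 0ℚ
    cancel = solve-∀ ring
    root : eval (c ∷ d ∷ []) x₀ ≡ 0ℚ
    root = trans (cong (λ z → z + x₀ * (d + x₀ * 0ℚ)) c≡-x₀d) (cancel x₀ d)

  T : ℚ
  T = fromℕℚ (2 ℕ.* suc (N ℕ.+ k ℕ.+ k))

  evalA : eval A x₀ ≡ (T ÷' fromℕℚ n) * eval B x₀
  evalA = *-cancelˡ (fromℕℚ≢0 n (s≤s z≤n)) (begin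
    fromℕℚ n * a                                ≡⟨ expand (fromℕℚ n) μ a ⟩
    (fromℕℚ n + μ) * a + - μ * a                ≡⟨ cong₂ (λ y z → y * a + z * a)
                                                     (sym (trans (cong fromℕℚ (total N k)) (fromℕℚ-+ n (suc (N ℕ.+ k ℕ.+ k))))) (sym τx₀≡-μ) ⟩
    τ * a + τ * x₀ * a                          ≡⟨ cong (λ z → z * a + z * x₀ * a) (fromℕℚ-* 2 (n ℕ.+ k)) ⟩
    two * ν * a + two * ν * x₀ * a              ≡⟨ collect two ν x₀ a ⟩
    two * (ν * (a + x₀ * a))                    ≡⟨ cong (two *_) eval-relation ⟩
    two * (μ * b)                               ≡⟨ sym (*-assoc two μ b) ⟩
    two * μ * b                                 ≡⟨ cong (_* b) (sym (fromℕℚ-* 2 (suc (N ℕ.+ k ℕ.+ k)))) ⟩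
    T * b                                       ≡⟨ cong (_* b) (sym (÷'-* {T} (fromℕℚ≢0 n (s≤s z≤n)))) ⟩
    fromℕℚ n * (T ÷' fromℕℚ n) * b              ≡⟨ *-assoc (fromℕℚ n) (T ÷' fromℕℚ n) b ⟩
    fromℕℚ n * ((T ÷' fromℕℚ n) * b)            ∎)
    where
    a = eval A x₀
    b = eval B x₀
    two = fromℕℚ 2
    total : ∀ N k → 2 ℕ.* (suc N ℕ.+ k) ≡ suc N ℕ.+ suc (N ℕ.+ k ℕ.+ k)
    total = solveℕ-∀
    expand : ∀ n m a → n * a ≡ (n + m) * a + - m * a
    expand = solve-∀ ring
    collect : ∀ t v x a → t * v * a + t * v * x * a ≡ t * (v * (a + x * a))
    collect = solve-∀ ring

  α-lead≢0 : α n ≢ 0ℚ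
  α-lead≢0 e = *-nonzero (sign≢0 (n ℕ.+ k)) (factorial≢0 (n ℕ.+ k ℕ.+ (n ℕ.+ k)))
    (trans (sym (α-coeff n ℕP.≤-refl)) (trans (cong (ν * X * fromℕℚ (n !) *_) e) (*-zeroʳ (ν * X * fromℕℚ (n !)))))

  β-lead≢0 : β N ≢ 0ℚ
  β-lead≢0 e = *-nonzero (sign≢0 (N ℕ.+ k)) (factorial≢0 (N ℕ.+ k ℕ.+ (N ℕ.+ k)))
    (trans (sym (β-coeff N ℕP.≤-refl)) (trans (cong (X * fromℕℚ (N !) *_) e) (*-zeroʳ (X * fromℕℚ (N !)))))

  R : ℚ
  R = resultant A B

  resultant-reduced : μ ^ℕ n * (α n * (α n * R)) ≡ sign n * d ^ℕ n * eval A x₀ * α 0 ^ℕ n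
  resultant-reduced = begin
    μ ^ℕ n * (α n * (α n * R))
      ≡⟨ cong (λ z → μ ^ℕ n * (α n * (α n * z)))
           (resultant-rows A B (degree-unique A n A-deg α-lead≢0) (degree-unique B N B-deg β-lead≢0)) ⟩
    μ ^ℕ n * (α n * (α n * detRows (rows (reversed A n) N ++ rows (reversed B N) n) id))
      ≡⟨ sylvester-reduction (reversed A n) (reversed B N) remainder ν μ N row-relation
           (reversed-vanish A n) remainder-vanish ⟩
    detRows (reversed A n ∷ rows remainder n) id * reversed A n n ^ℕ n
      ≡⟨ cong₂ (λ y z → y * z ^ℕ n)
           (trans (detRows-bordered remainder remainder-vanish n (reversed A n))
                  (bordered-eval remainder remainder-vanish x₀ c≡-x₀d n A A-deg))
           (reversed-last A n) ⟩
    sign n * d ^ℕ n * eval A x₀ * α 0 ^ℕ n ∎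

  L M : ℚ
  L = fromℕℚ ((n ℕ.+ k ℕ.+ (n ℕ.+ k)) !) ÷' fromℕℚ ((n !) ℕ.* ((n ℕ.+ k) !))
  M = fromℕℚ ((N ℕ.+ k ℕ.+ k) !) ÷' X

  Y : ℚ
  Y = fromℕℚ ((n !) ℕ.* ((n ℕ.+ k) !))

  Y-split : Y ≡ ν * X * fromℕℚ (n !)
  Y-split = trans (fromℕℚ-* (n !) ((n ℕ.+ k) !))
    (trans (*-comm (fromℕℚ (n !)) (fromℕℚ ((n ℕ.+ k) !))) (cong (_* fromℕℚ (n !)) (fromℕℚ-! (N ℕ.+ k))))

  Y≢0 : Y ≢ 0ℚ
  Y≢0 e = *-nonzero (factorial≢0 n) (factorial≢0 (n ℕ.+ k)) (trans (sym (fromℕℚ-* (n !) ((n ℕ.+ k) !))) e)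

  α-lead : α n ≡ sign (n ℕ.+ k) * L
  α-lead = *-cancelˡ Y≢0 (begin
    Y * α n                                                        ≡⟨ cong (_* α n) Y-split ⟩
    ν * X * fromℕℚ (n !) * α n                                     ≡⟨ α-coeff n ℕP.≤-refl ⟩
    sign (n ℕ.+ k) * fromℕℚ ((n ℕ.+ k ℕ.+ (n ℕ.+ k)) !)            ≡⟨ cong (sign (n ℕ.+ k) *_) (sym (÷'-* Y≢0)) ⟩
    sign (n ℕ.+ k) * (Y * L)                                       ≡⟨ exchange (sign (n ℕ.+ k)) Y L ⟩
    Y * (sign (n ℕ.+ k) * L)                                       ∎)

  L≢0 : L ≢ 0ℚ
  L≢0 e = α-lead≢0 (trans α-lead (trans (cong (sign (n ℕ.+ k) *_) e) (*-zeroʳ (sign (n ℕ.+ k)))))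

  να₀ : ν * α 0 ≡ sign k * (μ * M)
  να₀ = *-cancelˡ X≢0 (begin
    X * (ν * α 0)                                ≡⟨ regroup X ν (α 0) ⟩
    ν * X * fromℕℚ (0 !) * α 0                   ≡⟨ α-coeff 0 z≤n ⟩
    sign k * fromℕℚ (suc (N ℕ.+ k ℕ.+ k) !)      ≡⟨ cong (sign k *_) (fromℕℚ-! (N ℕ.+ k ℕ.+ k)) ⟩
    sign k * (μ * fromℕℚ ((N ℕ.+ k ℕ.+ k) !))    ≡⟨ cong (λ z → sign k * (μ * z)) (sym (÷'-* X≢0)) ⟩
    sign k * (μ * (X * M))                       ≡⟨ regroup′ (sign k) μ X M ⟩
    X * (sign k * (μ * M))                       ∎)
    where
    regroup : ∀ x v a → x * (v * a) ≡ v * x * 1ℚ * a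
    regroup = solve-∀ ring
    regroup′ : ∀ s m x y → s * (m * (x * y)) ≡ x * (s * (m * y))
    regroup′ = solve-∀ ring

  dα₀ : d * α 0 ≡ sign n * (μ * (L * M))
  dα₀ = begin
    ν * α n * α 0                                       ≡⟨ regroup ν (α n) (α 0) ⟩
    α n * (ν * α 0)                                     ≡⟨ cong₂ _*_ α-lead να₀ ⟩
    sign (n ℕ.+ k) * L * (sign k * (μ * M))             ≡⟨ cong (λ z → z * L * (sign k * (μ * M))) (sign-+ n k) ⟩
    sign n * sign k * L * (sign k * (μ * M))            ≡⟨ regroup′ (sign n) (sign k) L μ M ⟩
    sign k * sign k * (sign n * (μ * (L * M)))          ≡⟨ cong (_* (sign n * (μ * (L * M)))) (sign-sq k) ⟩
    1ℚ * (sign n * (μ * (L * M)))                       ≡⟨ *-identityˡ (sign n * (μ * (L * M))) ⟩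
    sign n * (μ * (L * M))                              ∎
    where
    regroup : ∀ v a b → v * a * b ≡ a * (v * b)
    regroup = solve-∀ ring
    regroup′ : ∀ s t l m q → s * t * l * (t * (m * q)) ≡ t * t * (s * (m * (l * q)))
    regroup′ = solve-∀ ring

  LLR : L * (L * R) ≡ L ^ℕ n * M ^ℕ n * eval A x₀
  LLR = *-cancelˡ (^ℕ-nonzero n μ≢0) (begin
    μ ^ℕ n * (L * (L * R))
      ≡⟨ sym (*-identityˡ (μ ^ℕ n * (L * (L * R)))) ⟩
    1ℚ * (μ ^ℕ n * (L * (L * R)))
      ≡⟨ cong (_* (μ ^ℕ n * (L * (L * R)))) (sym (sign-sq (n ℕ.+ k))) ⟩
    s * s * (μ ^ℕ n * (L * (L * R)))
      ≡⟨ insert-signs s (μ ^ℕ n) L R ⟩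
    μ ^ℕ n * (s * L * (s * L * R))
      ≡⟨ cong (λ z → μ ^ℕ n * (z * (z * R))) (sym α-lead) ⟩
    μ ^ℕ n * (α n * (α n * R))
      ≡⟨ resultant-reduced ⟩
    sign n * d ^ℕ n * eval A x₀ * α 0 ^ℕ n
      ≡⟨ regroup (sign n) (d ^ℕ n) (eval A x₀) (α 0 ^ℕ n) ⟩
    sign n * (d ^ℕ n * α 0 ^ℕ n) * eval A x₀
      ≡⟨ cong (λ z → sign n * z * eval A x₀) (trans (sym (^ℕ-* d (α 0) n)) (trans (cong (_^ℕ n) dα₀) powers)) ⟩
    sign n * (sign n ^ℕ n * (μ ^ℕ n * (L ^ℕ n * M ^ℕ n))) * eval A x₀
      ≡⟨ regroup′ (sign n) (sign n ^ℕ n) (μ ^ℕ n) (L ^ℕ n * M ^ℕ n) (eval A x₀) ⟩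
    sign n ^ℕ suc n * (μ ^ℕ n * (L ^ℕ n * M ^ℕ n * eval A x₀))
      ≡⟨ cong (_* (μ ^ℕ n * (L ^ℕ n * M ^ℕ n * eval A x₀))) (trans (sign-^ n (suc n)) (sign-pronic n)) ⟩
    1ℚ * (μ ^ℕ n * (L ^ℕ n * M ^ℕ n * eval A x₀))
      ≡⟨ *-identityˡ (μ ^ℕ n * (L ^ℕ n * M ^ℕ n * eval A x₀)) ⟩
    μ ^ℕ n * (L ^ℕ n * M ^ℕ n * eval A x₀) ∎)
    where
    s = sign (n ℕ.+ k)
    insert-signs : ∀ s m l r → s * s * (m * (l * (l * r))) ≡ m * (s * l * (s * l * r))
    insert-signs = solve-∀ ring
    regroup : ∀ s d e a → s * d * e * a ≡ s * (d * a) * e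
    regroup = solve-∀ ring
    regroup′ : ∀ s p m q e → s * (p * (m * q)) * e ≡ s * p * (m * (q * e))
    regroup′ = solve-∀ ring
    powers : (sign n * (μ * (L * M))) ^ℕ n ≡ sign n ^ℕ n * (μ ^ℕ n * (L ^ℕ n * M ^ℕ n))
    powers = trans (^ℕ-* (sign n) (μ * (L * M)) n) (cong (sign n ^ℕ n *_)
      (trans (^ℕ-* μ (L * M) n) (cong (μ ^ℕ n *_) (^ℕ-* L M n))))

  resultant-formula : R ≡ (T ÷' fromℕℚ n) * (L ^ℤ ((+ n) ℤ.- (+ 2))) * (M ^ℕ n) * eval B x₀
  resultant-formula = *-cancelˡ L≢0 (*-cancelˡ L≢0 (begin
    L * (L * R)
      ≡⟨ LLR ⟩
    L ^ℕ n * M ^ℕ n * eval A x₀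
      ≡⟨ cong₂ (λ y z → y * M ^ℕ n * z) (sym (^ℤ-minus-two N L≢0)) evalA ⟩
    L * (L * Lz) * M ^ℕ n * ((T ÷' fromℕℚ n) * eval B x₀)
      ≡⟨ regroup L Lz (M ^ℕ n) (T ÷' fromℕℚ n) (eval B x₀) ⟩
    L * (L * ((T ÷' fromℕℚ n) * Lz * M ^ℕ n * eval B x₀)) ∎))
    where
    Lz = L ^ℤ ((+ n) ℤ.- (+ 2))
    regroup : ∀ l z m t e → l * (l * z) * m * (t * e) ≡ l * (l * (t * z * m * e))
    regroup = solve-∀ ring

normalise-indices : ∀ k N (F : ℕ → ℕ → ℕ → ℕ → ℕ → ℕ → ℚ) {R : ℚ} →
  R ≡ F (suc (N ℕ.+ k ℕ.+ k)) (suc N ℕ.+ k ℕ.+ (suc N ℕ.+ k)) (suc N ℕ.+ k) (N ℕ.+ k ℕ.+ k) (N ℕ.+ k) (suc (N ℕ.+ k ℕ.+ k)) →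
  R ≡ F (2 ℕ.* k ℕ.+ suc N) (2 ℕ.* k ℕ.+ 2 ℕ.* suc N) (k ℕ.+ suc N) (2 ℕ.* k ℕ.+ suc N ∸ 1) (k ℕ.+ suc N ∸ 1) (suc N ℕ.+ 2 ℕ.* k)
normalise-indices k N F e = trans e (apply (e₁ k N) (e₂ k N) (e₃ k N) (cong (_∸ 1) (e₁ k N)) (cong (_∸ 1) (e₃ k N)) (e₄ k N))
  where
  apply : ∀ {a b c d e f a′ b′ c′ d′ e′ f′} → a′ ≡ a → b′ ≡ b → c′ ≡ c → d′ ≡ d → e′ ≡ e → f′ ≡ f →
    F a b c d e f ≡ F a′ b′ c′ d′ e′ f′
  apply refl refl refl refl refl refl = refl
  e₁ : ∀ k N → 2 ℕ.* k ℕ.+ suc N ≡ suc (N ℕ.+ k ℕ.+ k)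
  e₁ = solveℕ-∀
  e₂ : ∀ k N → 2 ℕ.* k ℕ.+ 2 ℕ.* suc N ≡ suc N ℕ.+ k ℕ.+ (suc N ℕ.+ k)
  e₂ = solveℕ-∀
  e₃ : ∀ k N → k ℕ.+ suc N ≡ suc N ℕ.+ k
  e₃ = solveℕ-∀
  e₄ : ∀ k N → suc N ℕ.+ 2 ℕ.* k ≡ suc (N ℕ.+ k ℕ.+ k)
  e₄ = solveℕ-∀

theorem6p2 : (k n : ℕ) → 1 ≤ n →
    (Pa Qa Pb Qb : Poly) →
    IsPQ (n ℕ.+ k) Pa Qa →
    IsPQ (n ∸ 1 ℕ.+ k) Pb Qb →
    resultant (derivN k Qa) (derivN k Qb)
    ≡ (fromℕℚ (2 ℕ.* (2 ℕ.* k ℕ.+ n)) ÷' fromℕℚ n)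
    * ((fromℕℚ ((2 ℕ.* k ℕ.+ 2 ℕ.* n) !) ÷' fromℕℚ ((n !) ℕ.* ((k ℕ.+ n) !)))
    ^ℤ ((+ n) ℤ.- (+ 2)))
    * ((fromℕℚ ((2 ℕ.* k ℕ.+ n ∸ 1) !) ÷' fromℕℚ ((k ℕ.+ n ∸ 1) !)) ^ℕ n)
    * eval (derivN k Qb)
    (- (fromℕℚ (n ℕ.+ 2 ℕ.* k) ÷' fromℕℚ (2 ℕ.* (n ℕ.+ k))))
theorem6p2 k (suc N) _ Pa Qa Pb Qb pqa pqb = normalise-indices k N
  (λ a b c d e f →
    (fromℕℚ (2 ℕ.* a) ÷' fromℕℚ (suc N))
    * ((fromℕℚ (b !) ÷' fromℕℚ ((suc N !) ℕ.* (c !))) ^ℤ ((+ suc N) ℤ.- (+ 2)))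
    * ((fromℕℚ (d !) ÷' fromℕℚ (e !)) ^ℕ suc N)
    * eval (derivN k Qb) (- (fromℕℚ f ÷' fromℕℚ (2 ℕ.* (suc N ℕ.+ k)))))
  (Consecutive.resultant-formula k N Pa Qa Pb Qb pqa pqb)
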